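{- Let $L$ be a finite nonempty ideal (downward closed subset) of the grid poset $(\mathbb{N}^n,\leq)$ with componentwise order, and let $d$ be the VC-dimension of $L$. Then $L$ has a realization in $\mathbb{R}^{2d}$; that is, $\dim_{\mathbb{E}}(L)\leq 2\,\mathrm{VC\text{ - }dim}(L)$.
   Context: Here $\mathbb{N}=\{0,1,2,\dots\}$. (Finite nonempty ideals of $(\mathbb{N}^n,\leq)$ correspond bijectively to multisimplicial complexes on an $n$-element set: families of multi-subsets closed under decreasing multiplicities.) A finite nonempty ideal $L$ of $(\mathbb{N}^n,\leq)$ is viewed as a set family as follows: let $U=\{(i,j): 1\leq i\leq n,\ j\geq 1,\ \exists x\in L \text{ with } x_i\geq j\}$ and identify $x\in L$ with the set $\{(i,j)\in U: j\leq x_i\}$. The VC-dimension of a family $\mathcal{S}\subseteq 2^U$ is the maximum size of $X\subseteq U$ with $\{S\cap X:S\in\mathcal{S}\}=2^X$. (For a finite nonempty ideal $L$ of $(\mathbb{N}^n,\leq)$, viewed as the set family $\{\{(i,j)\in U: j\leq x_i\}: x\in L\}$, it equals the dimension of the largest cube in $L$, i.e. the maximum number of nonzero coordinates of an element of $L$.) A realization of a family $\mathcal{S}\subseteq 2^U$ in $\mathbb{R}^m$ consists of oriented affine hyperplanes $(H_e)_{e\in U}$ of $\mathbb{R}^m$, where $H_e=\{x:a_e\cdot x=b_e\}$ with $a_e\neq 0$, $H_e^+=\{x:a_e\cdot x>b_e\}$, $H_e^-=\{x:a_e\cdot x<b_e\}$, and a relatively open convex set $K\subseteq\mathbb{R}^m$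 such that $X\subseteq U$ belongs to $\mathcal{S}$ if and only if there is $x\in K$ with $x\in H_e^+$ for all $e\in X$ and $x\in H_e^-$ for all $e\in U\setminus X$. The Euclidean dimension $\dim_{\mathbb{E}}(\mathcal{S})$ is the smallest $m$ such that $\mathcal{S}$ has a realization in $\mathbb{R}^m$. -}

module Defs where

open import Data.Fin.Base using (Fin)
open import Data.List.Base using (List; length)
open import Data.List.Membership.Propositional using () renaming (_∈_ to _∈ˡ_)
open import Data.List.Relation.Unary.Unique.Propositional using (Unique)
open import Data.Nat.Base as ℕ using (ℕ)
import Data.Nat.Properties as ℕₚ
open import Data.Product using (Σ; ∃; ∃-syntax; _×_; _,_)
open import Data.Rational.Base as ℚ using (ℚ; 0ℚ; 1ℚ; ½)
import Data.Rational.Properties as ℚₚ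
open import Data.Rational.Solver using (module +-*-Solver)
open import Data.Sum.Base using (_⊎_)
open import Data.Vec.Base using (Vec; lookup)
open import Data.Vec.Functional using (Vector; foldr)
open import Data.Vec.Relation.Binary.Pointwise.Inductive using (Pointwise)
open import Function.Bundles using (_⇔_)
open import Level using (0ℓ)
open import Relation.Binary.PropositionalEquality
open import Relation.Nullary.Negation using (¬_)
open import Relation.Unary using (Pred; _∈_; _⊆_; _∩_; _≐_; Decidable; Satisfiable)

-- Reals are Cauchy sequences of rationals, taken up to _≈_ below.

Cauchy : (ℕ → ℚ) → Set
Cauchy s = ∀ ε → 0ℚ ℚ.< ε →
  ∃[ N ] ∀ m n → N ℕ.≤ m → N ℕ.≤ n → ℚ.∣ s m ℚ.- s n ∣ ℚ.< ε

record ℝ : Set where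
  constructor mkℝ
  field
    seq    : ℕ → ℚ
    cauchy : Cauchy seq

open ℝ public

-- Abstract to keep the type checker from unfolding these proofs inside reals.
abstract
  +-regroup : ∀ a b c d →
    (a ℚ.+ b) ℚ.- (c ℚ.+ d) ≡ (a ℚ.- c) ℚ.+ (b ℚ.- d)
  +-regroup = solve 4 (λ a b c d →
    (a :+ b) :- (c :+ d) := (a :- c) :+ (b :- d)) refl
    where open +-*-Solver

  *-regroup : ∀ a b c d →
    a ℚ.* b ℚ.- c ℚ.* d ≡ a ℚ.* (b ℚ.- d) ℚ.+ d ℚ.* (a ℚ.- c)
  *-regroup = solve 4 (λ a b c d →
    a :* b :- c :* d := a :* (b :- d) :+ d :* (a :- c)) refl
    where open +-*-Solver

  cancel-sub : ∀ a b → a ≡ (a ℚ.- b) ℚ.+ b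
  cancel-sub = solve 2 (λ a b → a := (a :- b) :+ b) refl
    where open +-*-Solver

  triangle : ∀ {x} p q → x ≡ p ℚ.+ q → ℚ.∣ x ∣ ℚ.≤ ℚ.∣ p ∣ ℚ.+ ℚ.∣ q ∣
  triangle p q refl = ℚₚ.∣p+q∣≤∣p∣+∣q∣ p q

  0<1 : 0ℚ ℚ.< 1ℚ
  0<1 = ℚₚ.positive⁻¹ 1ℚ

  half : ∀ ε → 0ℚ ℚ.< ε → ∃[ δ ] (0ℚ ℚ.< δ) × (δ ℚ.+ δ ≡ ε)
  half ε 0<ε = ½ ℚ.* ε
    , ℚₚ.positive⁻¹ (½ ℚ.* ε) {{ℚₚ.pos*pos⇒pos ½ ε {{ℚ.positive 0<ε}}}}
    , trans (sym (ℚₚ.*-distribʳ-+ ε ½ ½)) (ℚₚ.*-identityˡ ε)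

  +-cauchy : ∀ s t → Cauchy s → Cauchy t → Cauchy (λ n → s n ℚ.+ t n)
  +-cauchy s t cs ct ε 0<ε with half ε 0<ε
  ... | δ , 0<δ , refl with cs δ 0<δ | ct δ 0<δ
  ... | M , hM | N , hN = M ℕ.⊔ N , λ m n p q →
    ℚₚ.≤-<-trans
      (triangle (s m ℚ.- s n) (t m ℚ.- t n)
        (+-regroup (s m) (t m) (s n) (t n)))
      (ℚₚ.+-mono-<
        (hM m n (ℕₚ.m⊔n≤o⇒m≤o M N p) (ℕₚ.m⊔n≤o⇒m≤o M N q))
        (hN m n (ℕₚ.m⊔n≤o⇒n≤o M N p) (ℕₚ.m⊔n≤o⇒n≤o M N q)))

  neg-cauchy : ∀ s → Cauchy s → Cauchy (λ n → ℚ.- s n)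
  neg-cauchy s cs ε 0<ε with cs ε 0<ε
  ... | N , h = N , λ m n p q →
    subst (ℚ._< ε)
      (trans (sym (ℚₚ.∣-p∣≡∣p∣ (s m ℚ.- s n)))
        (cong ℚ.∣_∣ (ℚₚ.neg-distrib-+ (s m) (ℚ.- s n))))
      (h m n p q)

  bounded : ∀ s → Cauchy s →
    ∃[ B ] (0ℚ ℚ.< B) × ∃[ N ] ∀ n → N ℕ.≤ n → ℚ.∣ s n ∣ ℚ.≤ B
  bounded s cs with cs 1ℚ 0<1
  ... | N , h = 1ℚ ℚ.+ ℚ.∣ s N ∣
      , ℚₚ.+-mono-<-≤ 0<1 (ℚₚ.0≤∣p∣ (s N))
      , N
      , λ n p → ℚₚ.≤-trans
          (triangle (s n ℚ.- s N) (s N) (cancel-sub (s n) (s N)))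
          (ℚₚ.+-monoˡ-≤ ℚ.∣ s N ∣ (ℚₚ.<⇒≤ (h n N p ℕₚ.≤-refl)))

  scale : ∀ B → 0ℚ ℚ.< B → ∀ ε → 0ℚ ℚ.< ε →
    ∃[ δ ] (0ℚ ℚ.< δ) × (B ℚ.* δ ≡ ε)
  scale B 0<B ε 0<ε = (ℚ.1/ B) ℚ.* ε
    , ℚₚ.positive⁻¹ ((ℚ.1/ B) ℚ.* ε)
        {{ℚₚ.pos*pos⇒pos (ℚ.1/ B) {{ℚₚ.1/pos⇒pos B}} ε}}
    , trans (sym (ℚₚ.*-assoc B (ℚ.1/ B) ε))
        (trans (cong (ℚ._* ε) (ℚₚ.*-inverseʳ B)) (ℚₚ.*-identityˡ ε))
    where instance
      B⁺ : ℚ.Positive B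
      B⁺ = ℚ.positive 0<B
      ε⁺ : ℚ.Positive ε
      ε⁺ = ℚ.positive 0<ε
      B≢0 : ℚ.NonZero B
      B≢0 = ℚₚ.pos⇒nonZero B

  ∣*∣-bound : ∀ {B δ} → 0ℚ ℚ.< B → ∀ x y →
    ℚ.∣ x ∣ ℚ.≤ B → ℚ.∣ y ∣ ℚ.< δ → ℚ.∣ x ℚ.* y ∣ ℚ.< B ℚ.* δ
  ∣*∣-bound {B} {δ} 0<B x y x≤B y<δ =
    ℚₚ.≤-<-trans
      (ℚₚ.≤-trans (ℚₚ.≤-reflexive (ℚₚ.∣p*q∣≡∣p∣*∣q∣ x y))
        (ℚₚ.*-monoʳ-≤-nonNeg ℚ.∣ y ∣ {{ℚₚ.∣-∣-nonNeg y}} x≤B))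
      (ℚₚ.*-monoʳ-<-pos B {{ℚ.positive 0<B}} y<δ)

  *-close : ∀ {A α B β} → 0ℚ ℚ.< A → 0ℚ ℚ.< B → ∀ a b c d →
    ℚ.∣ a ∣ ℚ.≤ A → ℚ.∣ b ℚ.- d ∣ ℚ.< α →
    ℚ.∣ d ∣ ℚ.≤ B → ℚ.∣ a ℚ.- c ∣ ℚ.< β →
    ℚ.∣ a ℚ.* b ℚ.- c ℚ.* d ∣ ℚ.< A ℚ.* α ℚ.+ B ℚ.* β
  *-close 0<A 0<B a b c d a≤A bd<α d≤B ac<β =
    ℚₚ.≤-<-trans
      (triangle (a ℚ.* (b ℚ.- d)) (d ℚ.* (a ℚ.- c)) (*-regroup a b c d))
      (ℚₚ.+-mono-< (∣*∣-bound 0<A a (b ℚ.- d) a≤A bd<α)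
                   (∣*∣-bound 0<B d (a ℚ.- c) d≤B ac<β))

  *-cauchy′ : ∀ (s t : ℕ → ℚ) {A α B β ε} → A ℚ.* α ℚ.+ B ℚ.* β ≡ ε →
    0ℚ ℚ.< A → 0ℚ ℚ.< B → ∀ M₀ N₀ M₁ N₁ →
    (∀ n → M₀ ℕ.≤ n → ℚ.∣ s n ∣ ℚ.≤ A) →
    (∀ n → N₀ ℕ.≤ n → ℚ.∣ t n ∣ ℚ.≤ B) →
    (∀ m n → M₁ ℕ.≤ m → M₁ ℕ.≤ n → ℚ.∣ t m ℚ.- t n ∣ ℚ.< α) →
    (∀ m n → N₁ ℕ.≤ m → N₁ ℕ.≤ n → ℚ.∣ s m ℚ.- s n ∣ ℚ.< β) →
    ∃[ N ] ∀ m n → N ℕ.≤ m → N ℕ.≤ n →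
      ℚ.∣ s m ℚ.* t m ℚ.- s n ℚ.* t n ∣ ℚ.< ε
  *-cauchy′ s t refl 0<A 0<B M₀ N₀ M₁ N₁ hA hB h₁ h₂ = K , λ m n p q →
    *-close 0<A 0<B (s m) (t m) (s n) (t n)
      (hA m (≤₁ p)) (h₁ m n (≤₃ p) (≤₃ q))
      (hB n (≤₂ q)) (h₂ m n (≤₄ p) (≤₄ q))
    where
    K : ℕ
    K = (M₀ ℕ.⊔ N₀) ℕ.⊔ (M₁ ℕ.⊔ N₁)
    ≤₁ : ∀ {k} → K ℕ.≤ k → M₀ ℕ.≤ k
    ≤₁ p = ℕₚ.m⊔n≤o⇒m≤o M₀ N₀ (ℕₚ.m⊔n≤o⇒m≤o (M₀ ℕ.⊔ N₀) (M₁ ℕ.⊔ N₁) p)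
    ≤₂ : ∀ {k} → K ℕ.≤ k → N₀ ℕ.≤ k
    ≤₂ p = ℕₚ.m⊔n≤o⇒n≤o M₀ N₀ (ℕₚ.m⊔n≤o⇒m≤o (M₀ ℕ.⊔ N₀) (M₁ ℕ.⊔ N₁) p)
    ≤₃ : ∀ {k} → K ℕ.≤ k → M₁ ℕ.≤ k
    ≤₃ p = ℕₚ.m⊔n≤o⇒m≤o M₁ N₁ (ℕₚ.m⊔n≤o⇒n≤o (M₀ ℕ.⊔ N₀) (M₁ ℕ.⊔ N₁) p)
    ≤₄ : ∀ {k} → K ℕ.≤ k → N₁ ℕ.≤ k
    ≤₄ p = ℕₚ.m⊔n≤o⇒n≤o M₁ N₁ (ℕₚ.m⊔n≤o⇒n≤o (M₀ ℕ.⊔ N₀) (M₁ ℕ.⊔ N₁) p)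

  *-cauchy : ∀ s t → Cauchy s → Cauchy t → Cauchy (λ n → s n ℚ.* t n)
  *-cauchy s t cs ct ε 0<ε =
    let δ , 0<δ , δ+δ≡ε = half ε 0<ε
        A , 0<A , M₀ , hA = bounded s cs
        B , 0<B , N₀ , hB = bounded t ct
        α , 0<α , Aα≡δ = scale A 0<A δ 0<δ
        β , 0<β , Bβ≡δ = scale B 0<B δ 0<δ
        M₁ , h₁ = ct α 0<α
        N₁ , h₂ = cs β 0<β
    in *-cauchy′ s t (trans (cong₂ ℚ._+_ Aα≡δ Bβ≡δ) δ+δ≡ε) 0<A 0<B
         M₀ N₀ M₁ N₁ hA hB h₁ h₂

  const-cauchy : ∀ q → Cauchy (λ _ → q)
  const-cauchy q ε 0<ε =
    0 , λ _ _ _ _ → subst (ℚ._< ε) (sym (cong ℚ.∣_∣ (ℚₚ.+-inverseʳ q))) 0<ε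

infixl 7 _*_
infixl 6 _+_ _-_
infix  8 -_
infix  4 _≈_ _<_ _≤_

fromℚ : ℚ → ℝ
fromℚ q = mkℝ (λ _ → q) (const-cauchy q)

0ℝ 1ℝ : ℝ
0ℝ = fromℚ 0ℚ
1ℝ = fromℚ 1ℚ

_+_ : ℝ → ℝ → ℝ
mkℝ s cs + mkℝ t ct = mkℝ (λ n → s n ℚ.+ t n) (+-cauchy s t cs ct)

_*_ : ℝ → ℝ → ℝ
mkℝ s cs * mkℝ t ct = mkℝ (λ n → s n ℚ.* t n) (*-cauchy s t cs ct)

-_ : ℝ → ℝ
- x = mkℝ (λ n → ℚ.- seq x n) (neg-cauchy (seq x) (cauchy x))

_-_ : ℝ → ℝ → ℝ
x - y = x + (- y)

record _≈_ (x y : ℝ) : Set where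
  constructor mk≈
  field
    close : ∀ ε → 0ℚ ℚ.< ε →
      ∃[ N ] ∀ n → N ℕ.≤ n → ℚ.∣ seq x n ℚ.- seq y n ∣ ℚ.< ε

record _<_ (x y : ℝ) : Set where
  constructor mk<
  field
    gap       : ℚ
    0<gap     : 0ℚ ℚ.< gap
    index     : ℕ
    separated : ∀ n → index ℕ.≤ n → seq x n ℚ.+ gap ℚ.≤ seq y n

_≤_ : ℝ → ℝ → Set
x ≤ y = ¬ (y < x)

sum : ∀ {k} → Vector ℝ k → ℝ
sum = foldr _+_ 0ℝ

infix 4 _≋_
infix 8 _·_

_≋_ : ∀ {m} → Vector ℝ m → Vector ℝ m → Set
x ≋ y = ∀ i → x i ≈ y i

_·_ : ∀ {m} → Vector ℝ m → Vector ℝ m → ℝ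
a · x = sum λ i → a i * x i

dist² : ∀ {m} → Vector ℝ m → Vector ℝ m → ℝ
dist² x y = sum λ i → (x i - y i) * (x i - y i)

-- The constructive (apartness) form of a ≠ 0.
NonZeroVec : ∀ {m} → Vector ℝ m → Set
NonZeroVec a = ∃[ i ] (a i < 0ℝ ⊎ 0ℝ < a i)

H⁺ H⁻ : ∀ {m} → Vector ℝ m → ℝ → Pred (Vector ℝ m) 0ℓ
H⁺ a b x = b < a · x
H⁻ a b x = a · x < b

-- Points of ℝ^m are identified up to _≋_, so subsets must respect it.
RespectsEq : ∀ {m} → Pred (Vector ℝ m) 0ℓ → Set
RespectsEq K = ∀ {x y} → x ≋ y → x ∈ K → y ∈ K

Convex : ∀ {m} → Pred (Vector ℝ m) 0ℓ → Set
Convex K = ∀ {x y} t → x ∈ K → y ∈ K → 0ℝ ≤ t → t ≤ 1ℝ →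
  (λ i → (1ℝ - t) * x i + t * y i) ∈ K

AffineHull : ∀ {m} → Pred (Vector ℝ m) 0ℓ → Pred (Vector ℝ m) 0ℓ
AffineHull {m} K y =
  ∃[ k ] Σ (Vector ℝ k) λ c → Σ (Vector (Vector ℝ m) k) λ p →
    (∀ j → p j ∈ K) × (sum c ≈ 1ℝ) × (y ≋ λ i → sum λ j → c j * p j i)

RelativelyOpen : ∀ {m} → Pred (Vector ℝ m) 0ℓ → Set
RelativelyOpen K = ∀ {x} → x ∈ K → ∃[ ε ] (0ℝ < ε) ×
  (∀ {y} → y ∈ AffineHull K → dist² x y < ε * ε → y ∈ K)

-- The ground set U is a subset of the type E; members are subsets of U in all
-- uses below.
record SetFamily (E : Set) : Set₁ where
  field
    ground  : Pred E 0ℓ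
    members : Pred (Pred E 0ℓ) 0ℓ

open SetFamily public

-- The subsets considered below are decidable ones, the constructive
-- counterpart of arbitrary subsets of a finite ground set.
record Subset {E : Set} (U : Pred E 0ℓ) (X : Pred E 0ℓ) : Set where
  field
    decidable : Decidable X
    included  : X ⊆ U

HasSize : {E : Set} → Pred E 0ℓ → ℕ → Set
HasSize {E} X k = Σ (List E) λ xs →
  Unique xs × (∀ e → e ∈ X ⇔ e ∈ˡ xs) × length xs ≡ k

Shattered : {E : Set} → SetFamily E → Pred E 0ℓ → Set₁
Shattered {E} 𝒮 X =
  ∀ Y → Subset X Y → Σ (Pred E 0ℓ) λ S → S ∈ members 𝒮 × (S ∩ X) ≐ Y

IsVCDim : {E : Set} → SetFamily E → ℕ → Set₁
IsVCDim {E} 𝒮 d =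
  (Σ (Pred E 0ℓ) λ X → Subset (ground 𝒮) X × Shattered 𝒮 X × HasSize X d) ×
  (∀ X k → Subset (ground 𝒮) X → Shattered 𝒮 X → HasSize X k → k ℕ.≤ d)

Cell : {E : Set} {m : ℕ} → Pred E 0ℓ → (E → Vector ℝ m) → (E → ℝ) →
  Pred E 0ℓ → Pred (Vector ℝ m) 0ℓ
Cell {E} U a b X x =
  ((e : E) → X e → H⁺ (a e) (b e) x) ×
  ((e : E) → U e → ¬ X e → H⁻ (a e) (b e) x)

-- The hyperplane H_e is { x | normal e · x ≈ offset e };
-- normal e and offset e matter only for e in the ground set.
record Realization {E : Set} (𝒮 : SetFamily E) (m : ℕ) : Set₁ where
  field
    normal         : E → Vector ℝ m
    offset         : E → ℝ
    normal≠0       : ∀ {e} → e ∈ ground 𝒮 → NonZeroVec (normal e)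
    K              : Pred (Vector ℝ m) 0ℓ
    respectsEq     : RespectsEq K
    convex         : Convex K
    relativelyOpen : RelativelyOpen K
    realizes       : ∀ X → Subset (ground 𝒮) X →
      X ∈ members 𝒮 ⇔
      Satisfiable (K ∩ Cell (ground 𝒮) normal offset X)

IsEuclideanDim : {E : Set} → SetFamily E → ℕ → Set₁
IsEuclideanDim 𝒮 m = Realization 𝒮 m × (∀ k → Realization 𝒮 k → m ℕ.≤ k)

IsIdeal : ∀ {n} → Pred (Vec ℕ n) 0ℓ → Set
IsIdeal L = ∀ {x y} → Pointwise ℕ._≤_ x y → y ∈ L → x ∈ L

Finite : ∀ {n} → Pred (Vec ℕ n) 0ℓ → Set
Finite {n} L = Σ (List (Vec ℕ n)) λ xs → ∀ x → x ∈ L ⇔ x ∈ˡ xs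

-- The elements (i , j) have i counted from 0 and j counted from 1.
idealGround : ∀ {n} → Pred (Vec ℕ n) 0ℓ → Pred (Fin n × ℕ) 0ℓ
idealGround L (i , j) = 1 ℕ.≤ j × ∃[ x ] x ∈ L × j ℕ.≤ lookup x i

idealSet : ∀ {n} → Pred (Vec ℕ n) 0ℓ → Vec ℕ n → Pred (Fin n × ℕ) 0ℓ
idealSet L x (i , j) = (i , j) ∈ idealGround L × j ℕ.≤ lookup x i

idealFamily : ∀ {n} → Pred (Vec ℕ n) 0ℓ → SetFamily (Fin n × ℕ)
idealFamily L = record
  { ground  = idealGround L
  ; members = λ S → ∃[ x ] x ∈ L × S ≐ idealSet L x
  }

{-# OPTIONS --safe #-}

-- Identify a point of ℝ^2d with the monic polynomial p of degree 2d that has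
-- it as coefficients; the value p(i) at the node i is then an affine function
-- of the point.  An element x of L has a support S of size at most d, so
--   Π_{s ∈ S} ((t - s)² + ε ^ x_s) · (t² + 1) ^ (d - |S|)
-- is such a polynomial, its "vertex", and its value at each node i lies between
-- ε ^ x_i and a constant times ε ^ x_i.  Let the positive side of H_(i,j) be
-- p(i) < τ ε ^ (j - 1), with τ about 1 / n and ε much smaller than τ: the
-- vertex of x then lies in the cell of x.  If y is not in L, then on the cell
-- of y the weighted sum of the p(i) ε ^ (1 - y_i) over the support of y is at
-- most n τ < 1, while it is at least 1 at every vertex.  Hence the open
-- polyhedron K on which all these sums exceed n τ meets exactly the cells of L.

module Submission where

open import Defs
  using (IsIdeal; Finite; idealFamily; IsVCDim; Realization; IsEuclideanDim;
    ℝ; seq; cauchy; fromℚ; 1ℝ; mk<; sum; RespectsEq; Convex; RelativelyOpen;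
    half; scale; bounded; Subset; HasSize; Shattered; members; idealGround;
    idealSet; H⁺; H⁻; Cell; NonZeroVec)
import Defs as D
import Data.Rational.Base as ℚ
import Data.Rational.Properties as ℚₚ
open import Algebra.Definitions.RawSemiring ℚ.+-*-rawSemiring using (_^_)
open import Data.Bool.Base using (if_then_else_)
open import Data.Empty using (⊥; ⊥-elim)
open import Data.Fin.Base as Fin using (Fin; toℕ)
import Data.Fin.Properties as Finₚ
open import Data.List.Base as List using (List; []; _∷_; length; allFin; filter)
import Data.List.Properties as Listₚ
import Data.List.Membership.DecPropositional as DecMembership
open import Data.List.Membership.Propositional using () renaming (_∈_ to _∈ˡ_)
open import Data.List.Membership.Propositional.Properties
  using (∈-filter⁺; ∈-filter⁻; ∈-allFin; ∈-map⁺; ∈-map⁻)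
open import Data.List.Relation.Unary.All as All using (All; []; _∷_)
open import Data.List.Relation.Unary.AllPairs using ([]; _∷_)
open import Data.List.Relation.Unary.Any using (here; there)
open import Data.List.Relation.Unary.Unique.Propositional using (Unique)
import Data.List.Relation.Unary.Unique.Propositional.Properties as Uniqueₚ
open import Data.Nat.Base as ℕ using (ℕ; zero; suc; _*_; _≤_)
import Data.Nat.Properties as ℕₚ
open import Data.Product using (Σ; ∃-syntax; _×_; _,_; proj₁; proj₂)
open import Data.Product.Properties using (,-injectiveˡ)
open import Data.Rational.Base using (ℚ; 0ℚ; 1ℚ)
open import Data.Rational.Solver using (module +-*-Solver)
open import Data.Sum.Base using (_⊎_; inj₁; inj₂)
open import Data.Vec.Base using (Vec; []; _∷_; lookup; tabulate)
open import Data.Vec.Functional using (Vector; foldr)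
import Data.Vec.Properties as Vecₚ
import Data.Vec.Relation.Binary.Pointwise.Extensional as Extensional
open import Data.Vec.Relation.Binary.Pointwise.Inductive using (Pointwise)
open import Function.Base using (_∘_; id)
open import Function.Bundles using (_⇔_; mk⇔; module Equivalence)
open import Level using (0ℓ)
open import Relation.Binary.Definitions using (tri<; tri≈; tri>)
open import Relation.Binary.PropositionalEquality
open import Relation.Nullary using (¬_; Dec; yes; no; contradiction; does)
open import Relation.Nullary.Decidable using (_×-dec_)
open import Relation.Unary using (Pred; _∈_; _≐_; Decidable; Satisfiable)
open +-*-Solver using (solve; _:+_; _:*_; _:-_; :-_; _:=_; con)

-- Rational inequalities, powers and sums

∑ : ∀ {k} → Vector ℚ k → ℚ
∑ = foldr ℚ._+_ 0ℚ

+-nonneg : ∀ {p q} → 0ℚ ℚ.≤ p → 0ℚ ℚ.≤ q → 0ℚ ℚ.≤ p ℚ.+ q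
+-nonneg = ℚₚ.+-mono-≤

*-nonneg : ∀ {p q} → 0ℚ ℚ.≤ p → 0ℚ ℚ.≤ q → 0ℚ ℚ.≤ p ℚ.* q
*-nonneg {p} {q} 0≤p 0≤q = subst (ℚ._≤ p ℚ.* q) (ℚₚ.*-zeroˡ q)
  (ℚₚ.*-monoʳ-≤-nonNeg q {{ℚ.nonNegative 0≤q}} 0≤p)

*-positive : ∀ {p q} → 0ℚ ℚ.< p → 0ℚ ℚ.< q → 0ℚ ℚ.< p ℚ.* q
*-positive {p} {q} 0<p 0<q =
  ℚₚ.positive⁻¹ (p ℚ.* q) {{ℚₚ.pos*pos⇒pos p {{ℚ.positive 0<p}} q {{ℚ.positive 0<q}}}}

*-monoʳ-≤ : ∀ {r p q} → 0ℚ ℚ.≤ r → p ℚ.≤ q → r ℚ.* p ℚ.≤ r ℚ.* q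
*-monoʳ-≤ {r} 0≤r = ℚₚ.*-monoˡ-≤-nonNeg r {{ℚ.nonNegative 0≤r}}

*-mono-≤ : ∀ {p q r s} → 0ℚ ℚ.≤ p → 0ℚ ℚ.≤ r → p ℚ.≤ q → r ℚ.≤ s →
  p ℚ.* r ℚ.≤ q ℚ.* s
*-mono-≤ {q = q} {r} 0≤p 0≤r p≤q r≤s = ℚₚ.≤-trans
  (ℚₚ.*-monoʳ-≤-nonNeg r {{ℚ.nonNegative 0≤r}} p≤q)
  (*-monoʳ-≤ (ℚₚ.≤-trans 0≤p p≤q) r≤s)

0≤q-p : ∀ {p q} → p ℚ.≤ q → 0ℚ ℚ.≤ q ℚ.- p
0≤q-p {p} {q} p≤q =
  subst (ℚ._≤ q ℚ.- p) (ℚₚ.+-inverseʳ p) (ℚₚ.+-monoˡ-≤ (ℚ.- p) p≤q)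

-- Reduces an inequality to a ring identity, left to the solver, and the sign of the remainder `r`.
≤-offset : ∀ {p q r} → q ≡ p ℚ.+ r → 0ℚ ℚ.≤ r → p ℚ.≤ q
≤-offset {p} refl 0≤r = ℚₚ.≤-trans (ℚₚ.≤-reflexive (sym (ℚₚ.+-identityʳ p))) (ℚₚ.+-monoʳ-≤ p 0≤r)

0≤1 : 0ℚ ℚ.≤ 1ℚ
0≤1 = ℚₚ.nonNegative⁻¹ 1ℚ

^-positive : ∀ {p} → 0ℚ ℚ.< p → ∀ k → 0ℚ ℚ.< p ^ k
^-positive 0<p zero    = ℚₚ.positive⁻¹ 1ℚ
^-positive 0<p (suc k) = *-positive 0<p (^-positive 0<p k)

^-nonneg : ∀ {p} → 0ℚ ℚ.≤ p → ∀ k → 0ℚ ℚ.≤ p ^ k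
^-nonneg 0≤p zero    = 0≤1
^-nonneg 0≤p (suc k) = *-nonneg 0≤p (^-nonneg 0≤p k)

1≤^ : ∀ {p} → 1ℚ ℚ.≤ p → ∀ k → 1ℚ ℚ.≤ p ^ k
1≤^ 1≤p zero    = ℚₚ.≤-refl
1≤^ 1≤p (suc k) = *-mono-≤ 0≤1 0≤1 1≤p (1≤^ 1≤p k)

^-monoˡ-≤ : ∀ {p q} → 0ℚ ℚ.≤ p → p ℚ.≤ q → ∀ k → p ^ k ℚ.≤ q ^ k
^-monoˡ-≤ 0≤p p≤q zero    = ℚₚ.≤-refl
^-monoˡ-≤ 0≤p p≤q (suc k) = *-mono-≤ 0≤p (^-nonneg 0≤p k) p≤q (^-monoˡ-≤ 0≤p p≤q k)

^-monoʳ-≤ : ∀ {p} → 1ℚ ℚ.≤ p → ∀ {j k} → j ℕ.≤ k → p ^ j ℚ.≤ p ^ k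
^-monoʳ-≤ 1≤p {k = k} ℕ.z≤n = 1≤^ 1≤p k
^-monoʳ-≤ 1≤p (ℕ.s≤s j≤k) = *-monoʳ-≤ (ℚₚ.≤-trans 0≤1 1≤p) (^-monoʳ-≤ 1≤p j≤k)

^-antimonoʳ-≤ : ∀ {p} → 0ℚ ℚ.≤ p → p ℚ.≤ 1ℚ → ∀ {j k} → j ℕ.≤ k → p ^ k ℚ.≤ p ^ j
^-antimonoʳ-≤ 0≤p p≤1 {k = zero} ℕ.z≤n = ℚₚ.≤-refl
^-antimonoʳ-≤ 0≤p p≤1 {k = suc k} ℕ.z≤n =
  *-mono-≤ 0≤p (^-nonneg 0≤p k) p≤1 (^-antimonoʳ-≤ 0≤p p≤1 {k = k} ℕ.z≤n)
^-antimonoʳ-≤ 0≤p p≤1 (ℕ.s≤s j≤k) = *-monoʳ-≤ 0≤p (^-antimonoʳ-≤ 0≤p p≤1 j≤k)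

^-inverse : ∀ {p q} → p ℚ.* q ≡ 1ℚ → ∀ k → p ^ k ℚ.* q ^ k ≡ 1ℚ
^-inverse pq≡1 zero = refl
^-inverse {p} {q} pq≡1 (suc k) = trans
  (solve 4 (λ a b c d → a :* b :* (c :* d) := a :* c :* (b :* d)) refl p (p ^ k) q (q ^ k))
  (cong₂ ℚ._*_ pq≡1 (^-inverse {p} {q} pq≡1 k))

∑-nonneg : ∀ {k} {f : Vector ℚ k} → (∀ i → 0ℚ ℚ.≤ f i) → 0ℚ ℚ.≤ ∑ f
∑-nonneg {zero}  0≤f = ℚₚ.≤-refl
∑-nonneg {suc k} 0≤f = +-nonneg (0≤f Fin.zero) (∑-nonneg (0≤f ∘ Fin.suc))

term≤∑ : ∀ {k} {f : Vector ℚ k} → (∀ i → 0ℚ ℚ.≤ f i) → ∀ i → f i ℚ.≤ ∑ f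
term≤∑ 0≤f Fin.zero = ≤-offset refl (∑-nonneg (0≤f ∘ Fin.suc))
term≤∑ {f = f} 0≤f (Fin.suc i) = ≤-offset
  (trans (cong (λ s → f Fin.zero ℚ.+ s) (solve 2 (λ s t → s := t :+ (s :- t)) refl _ (f (Fin.suc i))))
    (solve 3 (λ a t r → a :+ (t :+ r) := t :+ (a :+ r)) refl (f Fin.zero) (f (Fin.suc i)) _))
  (+-nonneg (0≤f Fin.zero) (0≤q-p (term≤∑ (0≤f ∘ Fin.suc) i)))

-- The natural number k as a rational; it serves both as an evaluation point and as the number of
-- terms of a sum.
node : ℕ → ℚ
node zero    = 0ℚ
node (suc k) = 1ℚ ℚ.+ node k

∑-mono-≤ : ∀ {k} {f g : Vector ℚ k} {c} → (∀ i → f i ℚ.≤ g i ℚ.+ c) → ∑ f ℚ.≤ ∑ g ℚ.+ node k ℚ.* c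
∑-mono-≤ {zero} {c = c} f≤g = ℚₚ.≤-reflexive
  (solve 1 (λ c → con 0ℚ := con 0ℚ :+ con 0ℚ :* c) refl c)
∑-mono-≤ {suc k} {f} {g} {c} f≤g = ℚₚ.≤-trans
  (ℚₚ.+-mono-≤ (f≤g Fin.zero) (∑-mono-≤ (f≤g ∘ Fin.suc)))
  (ℚₚ.≤-reflexive (solve 4 (λ a c s k → a :+ c :+ (s :+ k :* c) := a :+ s :+ (con 1ℚ :+ k) :* c)
    refl (g Fin.zero) c (∑ (g ∘ Fin.suc)) (node k)))

∑≤ : ∀ {k} {f : Vector ℚ k} {c} → (∀ i → f i ℚ.≤ c) → ∑ f ℚ.≤ node k ℚ.* c
∑≤ {zero} {c = c} f≤c = ℚₚ.≤-reflexive (sym (ℚₚ.*-zeroˡ c))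
∑≤ {suc k} {f} {c} f≤c = ℚₚ.≤-trans
  (ℚₚ.+-mono-≤ (f≤c Fin.zero) (∑≤ (f≤c ∘ Fin.suc)))
  (ℚₚ.≤-reflexive (solve 2 (λ c k → c :+ k :* c := (con 1ℚ :+ k) :* c) refl c (node k)))

∑-cong : ∀ {k} {f g : Vector ℚ k} → f ≗ g → ∑ f ≡ ∑ g
∑-cong {zero}  f≗g = refl
∑-cong {suc k} f≗g = cong₂ ℚ._+_ (f≗g Fin.zero) (∑-cong (f≗g ∘ Fin.suc))

∑-combine : ∀ {k} a b (f g : Vector ℚ k) →
  ∑ (λ i → a ℚ.* f i ℚ.+ b ℚ.* g i) ≡ a ℚ.* ∑ f ℚ.+ b ℚ.* ∑ g
∑-combine {zero}  a b f g = solve 2 (λ a b → con 0ℚ := a :* con 0ℚ :+ b :* con 0ℚ) refl a b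
∑-combine {suc k} a b f g = trans
  (cong (λ s → a ℚ.* f Fin.zero ℚ.+ b ℚ.* g Fin.zero ℚ.+ s) (∑-combine a b (f ∘ Fin.suc) (g ∘ Fin.suc)))
  (solve 6 (λ a b x y s t → a :* x :+ b :* y :+ (a :* s :+ b :* t) := a :* (x :+ s) :+ b :* (y :+ t))
    refl a b (f Fin.zero) (g Fin.zero) (∑ (f ∘ Fin.suc)) (∑ (g ∘ Fin.suc)))

∑-scale : ∀ {k} a (f : Vector ℚ k) → ∑ (λ i → a ℚ.* f i) ≡ a ℚ.* ∑ f
∑-scale {zero}  a f = sym (ℚₚ.*-zeroʳ a)
∑-scale {suc k} a f = trans (cong (λ s → a ℚ.* f Fin.zero ℚ.+ s) (∑-scale a (f ∘ Fin.suc)))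
  (sym (ℚₚ.*-distribˡ-+ a (f Fin.zero) (∑ (f ∘ Fin.suc))))

-- Monic polynomials as points

-- The points of ℚ^m are the monic polynomials of degree m, lowest coefficient first.
monic : ∀ {m} → Vec ℚ m → ℚ → ℚ
monic []       t = 1ℚ
monic (c ∷ cs) t = c ℚ.+ t ℚ.* monic cs t

-- The top coefficient is fixed at 1 and is not a coordinate, so the value is affine in `q`.
eval : ∀ {m} → ℚ → Vector ℚ m → ℚ
eval {m} t q = t ^ m ℚ.+ ∑ (λ k → t ^ toℕ k ℚ.* q k)

-- Products are computed in Horner form, whereas hyperplanes need the explicit sum over
-- coefficients.
eval≡monic : ∀ {m} t (cs : Vec ℚ m) → eval t (lookup cs) ≡ monic cs t
eval≡monic t []       = refl
eval≡monic {suc m} t (c ∷ cs) = begin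
  t ℚ.* t ^ m ℚ.+ (1ℚ ℚ.* c ℚ.+ ∑ (λ k → t ℚ.* t ^ toℕ k ℚ.* lookup cs k))
    ≡⟨ cong (λ s → t ℚ.* t ^ m ℚ.+ (1ℚ ℚ.* c ℚ.+ s)) (trans
      (∑-cong (λ k → ℚₚ.*-assoc t (t ^ toℕ k) (lookup cs k))) (∑-scale t (λ k → t ^ toℕ k ℚ.* lookup cs k))) ⟩
  t ℚ.* t ^ m ℚ.+ (1ℚ ℚ.* c ℚ.+ t ℚ.* ∑ (λ k → t ^ toℕ k ℚ.* lookup cs k))
    ≡⟨ solve 4 (λ t p c s → t :* p :+ (con 1ℚ :* c :+ t :* s) := c :+ t :* (p :+ s))
      refl t (t ^ m) c (∑ (λ k → t ^ toℕ k ℚ.* lookup cs k)) ⟩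
  c ℚ.+ t ℚ.* eval t (lookup cs)
    ≡⟨ cong (λ s → c ℚ.+ t ℚ.* s) (eval≡monic t cs) ⟩
  c ℚ.+ t ℚ.* monic cs t ∎
  where open ≡-Reasoning

-- Coefficients of F p with F = t² + b t + e. For p = c + t p′ this is c F + t (F p′), so beyond the
-- shift only the entries `r₀` and `r₁` of F p′ change.
mulQuadratic : ∀ {m} → ℚ → ℚ → Vec ℚ m → Vec ℚ (2 ℕ.+ m)
mulQuadratic b e []       = e ∷ b ∷ []
mulQuadratic b e (c ∷ cs) with mulQuadratic b e cs
... | r₀ ∷ r₁ ∷ rs = c ℚ.* e ∷ r₀ ℚ.+ c ℚ.* b ∷ r₁ ℚ.+ c ∷ rs

monic-mulQuadratic : ∀ {m} b e (cs : Vec ℚ m) t →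
  monic (mulQuadratic b e cs) t ≡ (t ℚ.* t ℚ.+ b ℚ.* t ℚ.+ e) ℚ.* monic cs t
monic-mulQuadratic b e [] t =
  solve 3 (λ b e t → e :+ t :* (b :+ t :* con 1ℚ) := (t :* t :+ b :* t :+ e) :* con 1ℚ) refl b e t
monic-mulQuadratic b e (c ∷ cs) t
  with mulQuadratic b e cs | monic-mulQuadratic b e cs t
... | r₀ ∷ r₁ ∷ rs | ih = trans
  (solve 7 (λ b e c t x y r →
      c :* e :+ t :* (x :+ c :* b :+ t :* (y :+ c :+ t :* r)) :=
      (t :* t :+ b :* t :+ e) :* c :+ t :* (x :+ t :* (y :+ t :* r)))
    refl b e c t r₀ r₁ (monic rs t))
  (trans (cong (λ s → (t ℚ.* t ℚ.+ b ℚ.* t ℚ.+ e) ℚ.* c ℚ.+ t ℚ.* s) ih)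
    (solve 4 (λ F c t p → F :* c :+ t :* (F :* p) := F :* (c :+ t :* p))
      refl (t ℚ.* t ℚ.+ b ℚ.* t ℚ.+ e) c t (monic cs t)))

-- Spacing of the nodes

0≤node : ∀ k → 0ℚ ℚ.≤ node k
0≤node zero    = ℚₚ.≤-refl
0≤node (suc k) = +-nonneg 0≤1 (0≤node k)

node-mono-≤ : ∀ {i j} → i ℕ.≤ j → node i ℚ.≤ node j
node-mono-≤ {j = j} ℕ.z≤n = 0≤node j
node-mono-≤ (ℕ.s≤s i≤j) = ℚₚ.+-monoʳ-≤ 1ℚ (node-mono-≤ i≤j)

square-flip : ∀ p q → (p ℚ.- q) ℚ.* (p ℚ.- q) ≡ (q ℚ.- p) ℚ.* (q ℚ.- p)
square-flip = solve 2 (λ p q → (p :- q) :* (p :- q) := (q :- p) :* (q :- p)) refl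

1≤[q-p]² : ∀ {p q} → 1ℚ ℚ.+ p ℚ.≤ q → 1ℚ ℚ.≤ (q ℚ.- p) ℚ.* (q ℚ.- p)
1≤[q-p]² {p} {q} 1+p≤q = *-mono-≤ 0≤1 0≤1 1≤ 1≤
  where
  1≤ : 1ℚ ℚ.≤ q ℚ.- p
  1≤ = ≤-offset (solve 2 (λ p q → q :- p := con 1ℚ :+ (q :- (con 1ℚ :+ p))) refl p q) (0≤q-p 1+p≤q)

-- Distinct natural numbers differ by at least 1; this keeps a factor centred at one node from being
-- small at another.
node-separated : ∀ {i j} → i ≢ j → 1ℚ ℚ.≤ (node i ℚ.- node j) ℚ.* (node i ℚ.- node j)
node-separated {i} {j} i≢j with ℕₚ.<-cmp i j
... | tri< i<j _ _ = subst (1ℚ ℚ.≤_) (square-flip (node j) (node i)) (1≤[q-p]² (node-mono-≤ i<j))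
... | tri≈ _ i≡j _ = contradiction i≡j i≢j
... | tri> _ _ j<i = 1≤[q-p]² (node-mono-≤ j<i)

[q-p]²≤N² : ∀ {p q N} → 0ℚ ℚ.≤ p → p ℚ.≤ q → q ℚ.≤ N → (q ℚ.- p) ℚ.* (q ℚ.- p) ℚ.≤ N ℚ.* N
[q-p]²≤N² {p} {q} {N} 0≤p p≤q q≤N = *-mono-≤ (0≤q-p p≤q) (0≤q-p p≤q) ≤N ≤N
  where
  ≤N : q ℚ.- p ℚ.≤ N
  ≤N = ≤-offset (solve 3 (λ p q N → N := (q :- p) :+ (p :+ (N :- q))) refl p q N)
    (+-nonneg 0≤p (0≤q-p q≤N))

node-bounded : ∀ {i j n} → i ℕ.≤ n → j ℕ.≤ n →
  (node i ℚ.- node j) ℚ.* (node i ℚ.- node j) ℚ.≤ node n ℚ.* node n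
node-bounded {i} {j} {n} i≤n j≤n with ℕₚ.≤-total i j
... | inj₁ i≤j = subst (ℚ._≤ node n ℚ.* node n) (square-flip (node j) (node i))
  ([q-p]²≤N² (0≤node i) (node-mono-≤ i≤j) (node-mono-≤ j≤n))
... | inj₂ j≤i = [q-p]²≤N² (0≤node j) (node-mono-≤ j≤i) (node-mono-≤ i≤n)

-- Interval bounds for products of quadratic factors

infix 4 _∈[_,_]
_∈[_,_] : ℚ → ℚ → ℚ → Set
v ∈[ l , u ] = l ℚ.≤ v × v ℚ.≤ u

*-interval : ∀ {a x b c y d} → 0ℚ ℚ.≤ a → 0ℚ ℚ.≤ c →
  x ∈[ a , b ] → y ∈[ c , d ] → x ℚ.* y ∈[ a ℚ.* c , b ℚ.* d ]
*-interval 0≤a 0≤c (a≤x , x≤b) (c≤y , y≤d) =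
  *-mono-≤ 0≤a 0≤c a≤x c≤y ,
  *-mono-≤ (ℚₚ.≤-trans 0≤a a≤x) (ℚₚ.≤-trans 0≤c c≤y) x≤b y≤d

interval-≡ : ∀ {v v′ l l′ u u′} → v ≡ v′ → l ≡ l′ → u ≡ u′ → v ∈[ l , u ] → v′ ∈[ l′ , u′ ]
interval-≡ refl refl refl v∈ = v∈

point : ∀ {n} → Fin n → ℚ
point i = node (toℕ i)

-- Dominates every quadratic factor at every node: squared distances are at most n², and the added
-- constant is at most 1.
factorBound : ℕ → ℚ
factorBound n = node n ℚ.* node n ℚ.+ 1ℚ

1≤factorBound : ∀ n → 1ℚ ℚ.≤ factorBound n
1≤factorBound n = ≤-offset (ℚₚ.+-comm (node n ℚ.* node n) 1ℚ) (*-nonneg (0≤node n) (0≤node n))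

module Product {n : ℕ} (e : Fin n → ℚ) (0≤e : ∀ i → 0ℚ ℚ.≤ e i) (e≤1 : ∀ i → e i ℚ.≤ 1ℚ) where

  private
    D : ℚ
    D = factorBound n

  -- Once the list runs out, the remaining factors are t² + 1, so that all products have the same
  -- degree 2 d.
  product : ∀ d → List (Fin n) → Vec ℚ (d ℕ.* 2)
  product zero    _        = []
  product (suc d) []       = mulQuadratic 0ℚ 1ℚ (product d [])
  product (suc d) (s ∷ ss) =
    mulQuadratic (ℚ.- (point s ℚ.+ point s)) (point s ℚ.* point s ℚ.+ e s) (product d ss)

  factor : Fin n → Fin n → ℚ
  factor s i = (point i ℚ.- point s) ℚ.* (point i ℚ.- point s) ℚ.+ e s

  monic-product : ∀ d s ss i →
    monic (product (suc d) (s ∷ ss)) (point i) ≡ factor s i ℚ.* monic (product d ss) (point i)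
  monic-product d s ss i = trans
    (monic-mulQuadratic _ _ (product d ss) (point i))
    (cong (ℚ._* monic (product d ss) (point i))
      (solve 3 (λ t s e → t :* t :+ (:- (s :+ s)) :* t :+ (s :* s :+ e) := (t :- s) :* (t :- s) :+ e)
        refl (point i) (point s) (e s)))

  factor-off : ∀ {s i} → i ≢ s → factor s i ∈[ 1ℚ , D ]
  factor-off {s} {i} i≢s =
    ≤-trans (node-separated (i≢s ∘ Finₚ.toℕ-injective)) (≤-offset refl (0≤e s)) ,
    ℚₚ.+-mono-≤ (node-bounded (Finₚ.toℕ≤n i) (Finₚ.toℕ≤n s)) (e≤1 s)
    where open ℚₚ using (≤-trans)

  -- At its own centre the factor equals `e i`; the slack `D` lets each of the d factors account for
  -- one power of `D`.
  factor-on : ∀ i → factor i i ∈[ e i , D ℚ.* e i ]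
  factor-on i = ≤-reflexive (sym eq) , ≤-trans (≤-reflexive eq)
    (≤-offset (solve 2 (λ d e → d :* e := e :+ (d :- con 1ℚ) :* e) refl D (e i))
      (*-nonneg (0≤q-p (1≤factorBound n)) (0≤e i)))
    where
    open ℚₚ using (≤-trans; ≤-reflexive)
    eq : factor i i ≡ e i
    eq = solve 2 (λ t e → (t :- t) :* (t :- t) :+ e := e) refl (point i) (e i)

  -- Every factor, padding included, lies between 1 and `D` at a node outside the list.
  product-off : ∀ d ss i → All (i ≢_) ss → monic (product d ss) (point i) ∈[ 1ℚ , D ^ d ]
  product-off zero    ss i i∉ss = ℚₚ.≤-refl , ℚₚ.≤-refl
  product-off (suc d) [] i []   = subst (_∈[ 1ℚ , D ^ suc d ])
    (sym (monic-mulQuadratic 0ℚ 1ℚ (product d []) (point i)))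
    (*-interval 0≤1 0≤1 (1≤ , ≤D) (product-off d [] i []))
    where
    t = point i
    1≤ : 1ℚ ℚ.≤ t ℚ.* t ℚ.+ 0ℚ ℚ.* t ℚ.+ 1ℚ
    1≤ = ≤-offset (solve 1 (λ t → t :* t :+ con 0ℚ :* t :+ con 1ℚ := con 1ℚ :+ t :* t) refl t)
      (*-nonneg (0≤node (toℕ i)) (0≤node (toℕ i)))
    ≤D : t ℚ.* t ℚ.+ 0ℚ ℚ.* t ℚ.+ 1ℚ ℚ.≤ D
    ≤D = ℚₚ.≤-trans
      (ℚₚ.≤-reflexive (solve 1 (λ t → t :* t :+ con 0ℚ :* t :+ con 1ℚ := t :* t :+ con 1ℚ) refl t))
      (ℚₚ.+-monoˡ-≤ 1ℚ (*-mono-≤ (0≤node (toℕ i)) (0≤node (toℕ i)) t≤n t≤n))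
      where
      t≤n : t ℚ.≤ node n
      t≤n = node-mono-≤ (Finₚ.toℕ≤n i)
  product-off (suc d) (s ∷ ss) i (i≢s ∷ i∉ss) =
    subst (_∈[ 1ℚ , D ^ suc d ]) (sym (monic-product d s ss i))
      (*-interval 0≤1 0≤1 (factor-off i≢s) (product-off d ss i i∉ss))

  -- By uniqueness exactly one factor is centred at i and contributes `e i`; all others lie between
  -- 1 and `D`. The length bound ensures that the factor of i is not cut off.
  product-on : ∀ d {ss i} → Unique ss → i ∈ˡ ss → length ss ℕ.≤ d →
    monic (product d ss) (point i) ∈[ e i , D ^ d ℚ.* e i ]
  product-on (suc d) {s ∷ ss} {i} (i∉ss ∷ u) (here refl) (ℕ.s≤s ∣ss∣≤d) =
    interval-≡ (sym (monic-product d i ss i)) (ℚₚ.*-identityʳ (e i))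
      (solve 3 (λ a b c → a :* b :* c := a :* c :* b) refl D (e i) (D ^ d))
      (*-interval (0≤e i) 0≤1 (factor-on i) (product-off d ss i i∉ss))
  product-on (suc d) {s ∷ ss} {i} (s∉ss ∷ u) (there i∈ss) (ℕ.s≤s ∣ss∣≤d) =
    interval-≡ (sym (monic-product d s ss i)) (ℚₚ.*-identityˡ (e i)) (sym (ℚₚ.*-assoc D (D ^ d) (e i)))
      (*-interval 0≤1 (0≤e i)
        (factor-off (λ i≡s → All.lookup s∉ss i∈ss (sym i≡s))) (product-on d u i∈ss ∣ss∣≤d))

-- Open polyhedra in ℝ^m

-- Statements about reals are reduced to rational ones about their approximations from some index
-- on.
Eventually : (ℕ → Set) → Set
Eventually P = ∃[ N ] ∀ k → N ℕ.≤ k → P k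

eventually-map : ∀ {P Q : ℕ → Set} → (∀ {k} → P k → Q k) → Eventually P → Eventually Q
eventually-map f (N , p) = N , λ k N≤k → f (p k N≤k)

eventually-⊥ : ¬ Eventually (λ _ → ⊥)
eventually-⊥ (N , never) = never N ℕₚ.≤-refl

eventually-× : ∀ {P Q : ℕ → Set} → Eventually P → Eventually Q → Eventually (λ k → P k × Q k)
eventually-× (M , p) (N , q) = M ℕ.⊔ N , λ k ≤k →
  p k (ℕₚ.m⊔n≤o⇒m≤o M N ≤k) , q k (ℕₚ.m⊔n≤o⇒n≤o M N ≤k)

eventually-∀ : ∀ {n} {P : Fin n → ℕ → Set} →
  (∀ i → Eventually (P i)) → Eventually (λ k → ∀ i → P i k)
eventually-∀ {zero}  p = 0 , λ _ _ ()
eventually-∀ {suc n} p = eventually-map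
  (λ { (p₀ , ps) Fin.zero → p₀ ; (p₀ , ps) (Fin.suc i) → ps i })
  (eventually-× (p Fin.zero) (eventually-∀ (p ∘ Fin.suc)))

p≤∣p∣ : ∀ p → p ℚ.≤ ℚ.∣ p ∣
p≤∣p∣ p with ℚₚ.≤-total 0ℚ p
... | inj₁ 0≤p = ℚₚ.≤-reflexive (sym (ℚₚ.0≤p⇒∣p∣≡p 0≤p))
... | inj₂ p≤0 = ℚₚ.≤-trans p≤0 (ℚₚ.0≤∣p∣ p)

∣p∣≤ : ∀ {p δ} → p ℚ.≤ δ → ℚ.- p ℚ.≤ δ → ℚ.∣ p ∣ ℚ.≤ δ
∣p∣≤ {p} p≤δ -p≤δ with ℚₚ.∣p∣≡p∨∣p∣≡-p p
... | inj₁ eq = subst (ℚ._≤ _) (sym eq) p≤δ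
... | inj₂ eq = subst (ℚ._≤ _) (sym eq) -p≤δ

p≤q+δ : ∀ {p q δ} → p ℚ.- q ℚ.≤ δ → p ℚ.≤ q ℚ.+ δ
p≤q+δ {p} {q} {δ} p-q≤δ = ≤-offset
  (solve 3 (λ p q δ → q :+ δ := p :+ (δ :- (p :- q))) refl p q δ) (0≤q-p p-q≤δ)

square-cancel-≤ : ∀ {p q} → 0ℚ ℚ.< q → p ℚ.* p ℚ.≤ q ℚ.* q → p ℚ.≤ q
square-cancel-≤ {p} {q} 0<q p²≤q² with p ℚₚ.≤? q
... | yes p≤q = p≤q
... | no  p≰q = contradiction (ℚₚ.<-≤-trans q²<p² p²≤q²) (ℚₚ.<-irrefl refl)
  where
  q<p : q ℚ.< p
  q<p = ℚₚ.≰⇒> p≰q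
  q²<p² : q ℚ.* q ℚ.< p ℚ.* p
  q²<p² = ℚₚ.<-≤-trans
    (ℚₚ.*-monoʳ-<-pos q {{ℚ.positive 0<q}} q<p)
    (ℚₚ.*-monoʳ-≤-nonNeg p {{ℚ.nonNegative (ℚₚ.<⇒≤ (ℚₚ.<-trans 0<q q<p))}} (ℚₚ.<⇒≤ q<p))

0<q-p : ∀ {p q} → p ℚ.< q → 0ℚ ℚ.< q ℚ.- p
0<q-p {p} {q} p<q =
  subst (ℚ._< q ℚ.- p) (ℚₚ.+-inverseʳ p) (ℚₚ.+-monoˡ-< (ℚ.- p) p<q)

at : ∀ {m} → Vector ℝ m → ℕ → Vector ℚ m
at x k i = seq (x i) k

seq-sum : ∀ {m} (v : Vector ℝ m) k → seq (sum v) k ≡ ∑ (at v k)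
seq-sum {zero}  v k = refl
seq-sum {suc m} v k = cong (seq (v Fin.zero) k ℚ.+_) (seq-sum (v ∘ Fin.suc) k)

-- Real _≤_ is a negation; Cauchyness makes it effective up to any δ > 0.
≤⇒eventually : ∀ {x y} → x D.≤ y → ∀ {δ} → 0ℚ ℚ.< δ → Eventually (λ k → seq x k ℚ.≤ seq y k ℚ.+ δ)
≤⇒eventually {x} {y} x≤y {δ} 0<δ with half δ 0<δ
... | h , 0<h , refl with cauchy (x D.- y) h 0<h
... | N , close = conclude (d N ℚₚ.≤? h)
  where
  d : ℕ → ℚ
  d k = seq x k ℚ.- seq y k
  conclude : _ → Eventually (λ k → seq x k ℚ.≤ seq y k ℚ.+ (h ℚ.+ h))
  conclude (yes dN≤h) = N , λ k N≤k → p≤q+δ {seq x k} {seq y k} (ℚₚ.≤-trans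
    (p≤q+δ {d k} {d N} (ℚₚ.≤-trans (p≤∣p∣ (d k ℚ.- d N)) (ℚₚ.<⇒≤ (close k N N≤k ℕₚ.≤-refl))))
    (ℚₚ.+-monoˡ-≤ h dN≤h))
  -- If x - y exceeds h at index N, it stays above the positive number `d N ℚ.- h` from there on,
  -- which is a gap for y < x.
  conclude (no dN≰h) = contradiction
    (mk< (d N ℚ.- h) (0<q-p (ℚₚ.≰⇒> dN≰h)) N λ k N≤k → ≤-offset
      (solve 4 (λ x y D h → x := y :+ (D :- h) :+ (h :- (D :- (x :- y)))) refl (seq x k) (seq y k) (d N) h)
      (0≤q-p (ℚₚ.≤-trans (p≤∣p∣ (d N ℚ.- d k)) (ℚₚ.<⇒≤ (close N k ℕₚ.≤-refl N≤k)))))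
    x≤y

eventually-bounded : ∀ {m} (x : Vector ℝ m) →
  ∃[ B ] 0ℚ ℚ.< B × Eventually (λ k → ∀ i → ℚ.∣ at x k i ∣ ℚ.≤ B)
eventually-bounded {zero}  x = 1ℚ , ℚₚ.positive⁻¹ 1ℚ , 0 , λ _ _ ()
eventually-bounded {suc m} x
  with bounded (seq (x Fin.zero)) (cauchy (x Fin.zero)) | eventually-bounded (x ∘ Fin.suc)
... | A , 0<A , x₀ | B , 0<B , xs = A ℚ.+ B , ℚₚ.+-mono-< 0<A 0<B , eventually-map
  (λ { (p , ps) Fin.zero    → ℚₚ.≤-trans p (≤-offset refl (ℚₚ.<⇒≤ 0<B))
     ; (p , ps) (Fin.suc i) → ℚₚ.≤-trans (ps i) (≤-offset (ℚₚ.+-comm A B) (ℚₚ.<⇒≤ 0<A)) })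
  (eventually-× x₀ xs)

mix : ∀ {m} → ℚ → Vector ℚ m → Vector ℚ m → Vector ℚ m
mix t u v i = (1ℚ ℚ.- t) ℚ.* u i ℚ.+ t ℚ.* v i

-- Approximations of a real in [0, 1] may leave the interval by δ; the nearest point of the interval
-- replaces them.
clip : ∀ {t δ} → 0ℚ ℚ.≤ δ → 0ℚ ℚ.≤ t ℚ.+ δ → t ℚ.≤ 1ℚ ℚ.+ δ →
  ∃[ τ ] τ ∈[ 0ℚ , 1ℚ ] × ℚ.∣ τ ℚ.- t ∣ ℚ.≤ δ
clip {t} {δ} 0≤δ 0≤t+δ t≤1+δ with ℚₚ.≤-total t 0ℚ | ℚₚ.≤-total t 1ℚ
... | inj₁ t≤0 | _ = 0ℚ , (ℚₚ.≤-refl , 0≤1) , ∣p∣≤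
  (≤-offset (solve 2 (λ t δ → δ := con 0ℚ :- t :+ (t :+ δ)) refl t δ) 0≤t+δ)
  (≤-offset (solve 2 (λ t δ → δ := :- (con 0ℚ :- t) :+ (con 0ℚ :- t :+ δ)) refl t δ)
    (+-nonneg (0≤q-p t≤0) 0≤δ))
... | inj₂ 0≤t | inj₁ t≤1 = t , (0≤t , t≤1) ,
  ∣p∣≤ (subst (ℚ._≤ δ) (sym (ℚₚ.+-inverseʳ t)) 0≤δ)
       (subst (ℚ._≤ δ) (solve 1 (λ t → con 0ℚ := :- (t :- t)) refl t) 0≤δ)
... | inj₂ _ | inj₂ 1≤t = 1ℚ , (0≤1 , ℚₚ.≤-refl) , ∣p∣≤
  (≤-offset (solve 2 (λ t δ → δ := con 1ℚ :- t :+ (t :- con 1ℚ :+ δ)) refl t δ)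
    (+-nonneg (0≤q-p 1≤t) 0≤δ))
  (≤-offset (solve 2 (λ t δ → δ := :- (con 1ℚ :- t) :+ (con 1ℚ :+ δ :- t)) refl t δ) (0≤q-p t≤1+δ))

mix-close : ∀ {t τ δ B} x y → 0ℚ ℚ.≤ δ →
  ℚ.∣ τ ℚ.- t ∣ ℚ.≤ δ → ℚ.∣ x ∣ ℚ.≤ B → ℚ.∣ y ∣ ℚ.≤ B →
  (1ℚ ℚ.- τ) ℚ.* x ℚ.+ τ ℚ.* y ℚ.≤ ((1ℚ ℚ.- t) ℚ.* x ℚ.+ t ℚ.* y) ℚ.+ (B ℚ.+ B) ℚ.* δ
mix-close {t} {τ} {δ} {B} x y 0≤δ τ≈t ∣x∣≤B ∣y∣≤B = p≤q+δ (begin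
  ((1ℚ ℚ.- τ) ℚ.* x ℚ.+ τ ℚ.* y) ℚ.- ((1ℚ ℚ.- t) ℚ.* x ℚ.+ t ℚ.* y)
    ≡⟨ solve 4 (λ t τ x y → ((con 1ℚ :- τ) :* x :+ τ :* y) :- ((con 1ℚ :- t) :* x :+ t :* y)
         := (y :- x) :* (τ :- t)) refl t τ x y ⟩
  (y ℚ.- x) ℚ.* (τ ℚ.- t)              ≤⟨ p≤∣p∣ _ ⟩
  ℚ.∣ (y ℚ.- x) ℚ.* (τ ℚ.- t) ∣        ≡⟨ ℚₚ.∣p*q∣≡∣p∣*∣q∣ (y ℚ.- x) (τ ℚ.- t) ⟩
  ℚ.∣ y ℚ.- x ∣ ℚ.* ℚ.∣ τ ℚ.- t ∣      ≤⟨ *-mono-≤ (ℚₚ.0≤∣p∣ _) (ℚₚ.0≤∣p∣ _)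
    (ℚₚ.≤-trans (ℚₚ.∣p-q∣≤∣p∣+∣q∣ y x) (ℚₚ.+-mono-≤ ∣y∣≤B ∣x∣≤B)) τ≈t ⟩
  (B ℚ.+ B) ℚ.* δ ∎)
  where open ℚₚ.≤-Reasoning

-- The family `ℓ` gives the affine inequalities `ℓ y` > `c`. Hypothesis `ℓ-mono` combines
-- monotonicity with a Lipschitz constant `C` common to all y.
module Polyhedron {m : ℕ} {I : Set} (ℓ : I → Vector ℚ m → ℚ) (c : ℚ)
  (C : ℚ) (0<C : 0ℚ ℚ.< C)
  (ℓ-mono : ∀ y {u v η} → 0ℚ ℚ.≤ η → (∀ i → u i ℚ.≤ v i ℚ.+ η) → ℓ y u ℚ.≤ ℓ y v ℚ.+ C ℚ.* η)
  (ℓ-affine : ∀ y t u v → ℓ y (mix t u v) ≡ (1ℚ ℚ.- t) ℚ.* ℓ y u ℚ.+ t ℚ.* ℓ y v)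
  where

  Inside : ℚ → Vector ℚ m → Set
  Inside g v = ∀ y → c ℚ.+ g ℚ.≤ ℓ y v

  -- A gap uniform in y makes K relatively open although I need not be finite.
  K : Pred (Vector ℝ m) 0ℓ
  K x = ∃[ g ] 0ℚ ℚ.< g × Eventually (λ k → Inside g (at x k))

  Inside-weaken : ∀ {g h v} → h ℚ.≤ g → Inside g v → Inside h v
  Inside-weaken h≤g inside y = ℚₚ.≤-trans (ℚₚ.+-monoʳ-≤ c h≤g) (inside y)

  Inside-mix : ∀ {g t u v} → t ∈[ 0ℚ , 1ℚ ] → Inside g u → Inside g v → Inside g (mix t u v)
  Inside-mix {g} {t} {u} {v} (0≤t , t≤1) inᵤ inᵥ y = begin
    c ℚ.+ g
      ≡⟨ solve 2 (λ t s → s := (con 1ℚ :- t) :* s :+ t :* s) refl t (c ℚ.+ g) ⟩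
    (1ℚ ℚ.- t) ℚ.* (c ℚ.+ g) ℚ.+ t ℚ.* (c ℚ.+ g)
      ≤⟨ ℚₚ.+-mono-≤ (*-monoʳ-≤ (0≤q-p t≤1) (inᵤ y)) (*-monoʳ-≤ 0≤t (inᵥ y)) ⟩
    (1ℚ ℚ.- t) ℚ.* ℓ y u ℚ.+ t ℚ.* ℓ y v
      ≡⟨ ℓ-affine y t u v ⟨
    ℓ y (mix t u v) ∎
    where open ℚₚ.≤-Reasoning

  -- Half of the gap pays for a perturbation of the coordinates by η = h / C, for all y at once.
  -- Invariance under equality, openness and convexity of `K` all rest on this.
  shrink : ∀ {g} → 0ℚ ℚ.< g → ∃[ h ] ∃[ η ] 0ℚ ℚ.< h × 0ℚ ℚ.< η ×
    (∀ {u v} → (∀ i → u i ℚ.≤ v i ℚ.+ η) → Inside g u → Inside h v)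
  shrink {g} 0<g with half g 0<g
  ... | h , 0<h , refl with scale C 0<C h 0<h
  ... | η , 0<η , Cη≡h = h , η , 0<h , 0<η , λ {u} {v} u≤v inside y → begin
    c ℚ.+ h                       ≡⟨ solve 2 (λ c h → c :+ h := c :+ (h :+ h) :- h) refl c h ⟩
    c ℚ.+ (h ℚ.+ h) ℚ.- h         ≤⟨ ℚₚ.+-monoˡ-≤ (ℚ.- h) (ℚₚ.≤-trans (inside y) (ℓ-mono y (ℚₚ.<⇒≤ 0<η) u≤v)) ⟩
    ℓ y v ℚ.+ C ℚ.* η ℚ.- h       ≡⟨ cong (λ s → ℓ y v ℚ.+ s ℚ.- h) Cη≡h ⟩
    ℓ y v ℚ.+ h ℚ.- h             ≡⟨ solve 2 (λ l h → l :+ h :- h := l) refl (ℓ y v) h ⟩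
    ℓ y v ∎
    where open ℚₚ.≤-Reasoning

  K-respectsEq : RespectsEq K
  K-respectsEq {x} {y} x≋y (g , 0<g , inside) with shrink 0<g
  ... | h , η , 0<h , 0<η , move = h , 0<h , eventually-map
    (λ { (near , inₓ) → move (λ i → p≤q+δ (ℚₚ.≤-trans (p≤∣p∣ _) (ℚₚ.<⇒≤ (near i)))) inₓ })
    (eventually-× (eventually-∀ (λ i → D._≈_.close (x≋y i) η 0<η)) inside)

  -- Each squared coordinate difference is at most the squared distance, so a distance below η moves
  -- every coordinate by at most η.
  K-relativelyOpen : RelativelyOpen K
  K-relativelyOpen {x} (g , 0<g , inside) with shrink 0<g
  ... | h , η , 0<h , 0<η , move = fromℚ η ,
    mk< η 0<η 0 (λ _ _ → ℚₚ.≤-reflexive (ℚₚ.+-identityˡ η)) ,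
    λ { {y} _ (mk< gap 0<gap N close) → h , 0<h , eventually-map
      (λ { {k} (≤η² , inₓ) → move (λ i → p≤q+δ (square-cancel-≤ 0<η (begin
        (at x k i ℚ.- at y k i) ℚ.* (at x k i ℚ.- at y k i)
          ≤⟨ term≤∑ {f = λ i → (at x k i ℚ.- at y k i) ℚ.* (at x k i ℚ.- at y k i)}
               (λ i → square-nonneg (at x k i ℚ.- at y k i)) i ⟩
        ∑ (λ i → (at x k i ℚ.- at y k i) ℚ.* (at x k i ℚ.- at y k i))
          ≡⟨ seq-sum (λ i → (x i D.- y i) D.* (x i D.- y i)) k ⟨
        seq (D.dist² x y) k
          ≤⟨ ≤-offset refl (ℚₚ.<⇒≤ 0<gap) ⟩
        seq (D.dist² x y) k ℚ.+ gap
          ≤⟨ ≤η² ⟩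
        η ℚ.* η ∎))) inₓ })
      (eventually-× (N , close) inside) }
    where
    open ℚₚ.≤-Reasoning
    square-nonneg : ∀ p → 0ℚ ℚ.≤ p ℚ.* p
    square-nonneg p with ℚₚ.≤-total 0ℚ p
    ... | inj₁ 0≤p = *-nonneg 0≤p 0≤p
    ... | inj₂ p≤0 = subst (0ℚ ℚ.≤_)
      (solve 1 (λ p → (con 0ℚ :- p) :* (con 0ℚ :- p) := p :* p) refl p) (*-nonneg (0≤q-p p≤0) (0≤q-p p≤0))

  -- At each index the approximation of t is clipped into [0, 1], where the combination keeps the
  -- gap g; undoing the clipping costs only η per coordinate.
  K-convex : Convex K
  K-convex {x} {y} t (g₁ , 0<g₁ , in₁) (g₂ , 0<g₂ , in₂) 0≤t t≤1 = combine (common 0<g₁ 0<g₂)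
    where
    common : ∀ {p q} → 0ℚ ℚ.< p → 0ℚ ℚ.< q → ∃[ r ] 0ℚ ℚ.< r × r ℚ.≤ p × r ℚ.≤ q
    common {p} {q} 0<p 0<q with ℚₚ.≤-total p q
    ... | inj₁ p≤q = p , 0<p , ℚₚ.≤-refl , p≤q
    ... | inj₂ q≤p = q , 0<q , q≤p , ℚₚ.≤-refl

    combine : ∃[ g ] 0ℚ ℚ.< g × g ℚ.≤ g₁ × g ℚ.≤ g₂ → K (λ i → (1ℝ D.- t) D.* x i D.+ t D.* y i)
    combine (g , 0<g , g≤g₁ , g≤g₂)
      with shrink 0<g | eventually-bounded x | eventually-bounded y
    ... | h , η , 0<h , 0<η , move | A , 0<A , x≤A | B , 0<B , y≤B
      -- As A + B bounds the coordinates of both points, this δ makes the error in `mix-close`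
      -- exactly η.
      with scale (A ℚ.+ B ℚ.+ (A ℚ.+ B)) (ℚₚ.+-mono-< 0<A+B 0<A+B) η 0<η
      where
      0<A+B : 0ℚ ℚ.< A ℚ.+ B
      0<A+B = ℚₚ.+-mono-< 0<A 0<B
    ... | δ , 0<δ , refl = h , 0<h , eventually-map
      (λ { {k} ((-δ≤t , t≤1+δ) , (∣x∣≤A , ∣y∣≤B) , (inₓ , inᵧ)) →
        let τ , τ∈ , τ≈t = clip (ℚₚ.<⇒≤ 0<δ) -δ≤t t≤1+δ in
        move
          (λ i → mix-close {seq t k} {τ} (at x k i) (at y k i) (ℚₚ.<⇒≤ 0<δ) τ≈t
            (ℚₚ.≤-trans (∣x∣≤A i) (≤-offset refl (ℚₚ.<⇒≤ 0<B)))
            (ℚₚ.≤-trans (∣y∣≤B i) (≤-offset (ℚₚ.+-comm A B) (ℚₚ.<⇒≤ 0<A))))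
          (Inside-mix τ∈ (Inside-weaken g≤g₁ inₓ) (Inside-weaken g≤g₂ inᵧ)) })
      (eventually-× (eventually-× (≤⇒eventually 0≤t 0<δ) (≤⇒eventually t≤1 0<δ))
        (eventually-× (eventually-× x≤A y≤B) (eventually-× in₁ in₂)))

-- The realization

-- The base 1 + n is at least 1 and above every node, so this single power dominates all
-- coefficients t ^ k in `eval`.
coefficientBound : ℕ → ℕ → ℚ
coefficientBound n m = (1ℚ ℚ.+ node n) ^ m

point^≤ : ∀ {n m} (i : Fin n) (k : Fin m) → point i ^ toℕ k ℚ.≤ coefficientBound n m
point^≤ {n} {m} i k = ℚₚ.≤-trans
  (^-monoˡ-≤ (0≤node (toℕ i))
    (ℚₚ.≤-trans (node-mono-≤ (Finₚ.toℕ≤n i)) (≤-offset (ℚₚ.+-comm 1ℚ (node n)) 0≤1)) (toℕ k))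
  (^-monoʳ-≤ (≤-offset refl (0≤node n)) (Finₚ.toℕ≤n k))

0≤coefficientBound : ∀ n m → 0ℚ ℚ.≤ coefficientBound n m
0≤coefficientBound n m = ^-nonneg (+-nonneg 0≤1 (0≤node n)) m

-- All coefficients are nonnegative, so only a one-sided bound on u is needed.
eval-mono : ∀ {n m} (i : Fin n) {u v : Vector ℚ m} {η} → 0ℚ ℚ.≤ η → (∀ k → u k ℚ.≤ v k ℚ.+ η) →
  eval (point i) u ℚ.≤ eval (point i) v ℚ.+ node m ℚ.* (coefficientBound n m ℚ.* η)
eval-mono {n} {m} i {u} {v} {η} 0≤η u≤v = ℚₚ.≤-trans
  (ℚₚ.+-monoʳ-≤ (t ^ m) (∑-mono-≤ {g = λ k → t ^ toℕ k ℚ.* v k} {c = coefficientBound n m ℚ.* η} term))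
  (ℚₚ.≤-reflexive (sym (ℚₚ.+-assoc (t ^ m) _ _)))
  where
  t = point i
  term : ∀ k → t ^ toℕ k ℚ.* u k ℚ.≤ t ^ toℕ k ℚ.* v k ℚ.+ coefficientBound n m ℚ.* η
  term k = begin
    t ^ toℕ k ℚ.* u k                            ≤⟨ *-monoʳ-≤ (^-nonneg (0≤node (toℕ i)) (toℕ k)) (u≤v k) ⟩
    t ^ toℕ k ℚ.* (v k ℚ.+ η)                    ≡⟨ ℚₚ.*-distribˡ-+ (t ^ toℕ k) (v k) η ⟩
    t ^ toℕ k ℚ.* v k ℚ.+ t ^ toℕ k ℚ.* η
      ≤⟨ ℚₚ.+-monoʳ-≤ (t ^ toℕ k ℚ.* v k) (ℚₚ.*-monoʳ-≤-nonNeg η {{ℚ.nonNegative 0≤η}} (point^≤ i k)) ⟩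
    t ^ toℕ k ℚ.* v k ℚ.+ coefficientBound n m ℚ.* η ∎
    where open ℚₚ.≤-Reasoning

eval-affine : ∀ {m} t s (u v : Vector ℚ m) →
  eval t (mix s u v) ≡ (1ℚ ℚ.- s) ℚ.* eval t u ℚ.+ s ℚ.* eval t v
eval-affine {m} t s u v = trans
  (cong (t ^ m ℚ.+_) (trans
    (∑-cong (λ k → solve 4 (λ p s x y →
        p :* ((con 1ℚ :- s) :* x :+ s :* y) := (con 1ℚ :- s) :* (p :* x) :+ s :* (p :* y))
      refl (t ^ toℕ k) s (u k) (v k)))
    (∑-combine (1ℚ ℚ.- s) s (λ k → t ^ toℕ k ℚ.* u k) (λ k → t ^ toℕ k ℚ.* v k))))
  (solve 4 (λ p s x y → p :+ ((con 1ℚ :- s) :* x :+ s :* y) := (con 1ℚ :- s) :* (p :+ x) :+ s :* (p :+ y))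
    refl (t ^ m) s (∑ (λ k → t ^ toℕ k ℚ.* u k)) (∑ (λ k → t ^ toℕ k ℚ.* v k)))

-- Hyperplanes given by the value at a node

module Hyperplane {m : ℕ} (t θ : ℚ) where

  -- The sign is reversed so that the positive side is p(t) < θ; the constant term t ^ m of `eval`
  -- moves into the offset.
  normal : Vector ℝ m
  normal k = fromℚ (ℚ.- (t ^ toℕ k))

  offset : ℝ
  offset = fromℚ (t ^ m ℚ.- θ)

  seq-normal : ∀ x k → seq (normal D.· x) k ≡ t ^ m ℚ.- eval t (at x k)
  seq-normal x k = begin
    seq (normal D.· x) k
      ≡⟨ seq-sum (λ i → normal i D.* x i) k ⟩
    ∑ (λ i → ℚ.- (t ^ toℕ i) ℚ.* at x k i)
      ≡⟨ ∑-cong (λ i → solve 2 (λ p x → :- p :* x := :- con 1ℚ :* (p :* x)) refl (t ^ toℕ i) (at x k i)) ⟩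
    ∑ (λ i → ℚ.- 1ℚ ℚ.* (t ^ toℕ i ℚ.* at x k i))
      ≡⟨ ∑-scale (ℚ.- 1ℚ) (λ i → t ^ toℕ i ℚ.* at x k i) ⟩
    ℚ.- 1ℚ ℚ.* ∑ (λ i → t ^ toℕ i ℚ.* at x k i)
      ≡⟨ solve 2 (λ p s → :- con 1ℚ :* s := p :- (p :+ s)) refl (t ^ m) (∑ (λ i → t ^ toℕ i ℚ.* at x k i)) ⟩
    t ^ m ℚ.- eval t (at x k) ∎
    where open ≡-Reasoning

  private
    strict : ∀ {p q gap} → 0ℚ ℚ.< gap → p ℚ.+ gap ℚ.≤ q → p ℚ.< q
    strict {p} {gap = gap} 0<gap ≤q = ℚₚ.<-≤-trans
      (subst (ℚ._< p ℚ.+ gap) (ℚₚ.+-identityʳ p) (ℚₚ.+-monoʳ-< p 0<gap)) ≤q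

    flip-< : ∀ {a p q} → a ℚ.- p ℚ.< a ℚ.- q → q ℚ.< p
    flip-< {a} {p} {q} lt = subst₂ ℚ._<_
      (solve 3 (λ a p q → p :+ q :- a :+ (a :- p) := q) refl a p q)
      (solve 3 (λ a p q → p :+ q :- a :+ (a :- q) := p) refl a p q)
      (ℚₚ.+-monoʳ-< (p ℚ.+ q ℚ.- a) lt)

    gap-≡ : ∀ a p q → a ℚ.- p ℚ.+ (p ℚ.- q) ≡ a ℚ.- q
    gap-≡ = solve 3 (λ a p q → a :- p :+ (p :- q) := a :- q) refl

  H⁺⇒< : ∀ {x} → x ∈ H⁺ normal offset → Eventually (λ k → eval t (at x k) ℚ.< θ)
  H⁺⇒< {x} (mk< gap 0<gap N sep) = N , λ k N≤k → flip-< {t ^ m}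
    (strict 0<gap (subst (t ^ m ℚ.- θ ℚ.+ gap ℚ.≤_) (seq-normal x k) (sep k N≤k)))

  H⁻⇒> : ∀ {x} → x ∈ H⁻ normal offset → Eventually (λ k → θ ℚ.< eval t (at x k))
  H⁻⇒> {x} (mk< gap 0<gap N sep) = N , λ k N≤k → flip-< {t ^ m}
    (strict 0<gap (subst (λ s → s ℚ.+ gap ℚ.≤ t ^ m ℚ.- θ) (seq-normal x k) (sep k N≤k)))

  <⇒H⁺ : ∀ {q} → eval t q ℚ.< θ → (fromℚ ∘ q) ∈ H⁺ normal offset
  <⇒H⁺ {q} lt = mk< (θ ℚ.- eval t q) (0<q-p lt) 0 λ k _ → ℚₚ.≤-reflexive
    (trans (gap-≡ (t ^ m) θ (eval t q)) (sym (seq-normal (fromℚ ∘ q) k)))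

  >⇒H⁻ : ∀ {q} → θ ℚ.< eval t q → (fromℚ ∘ q) ∈ H⁻ normal offset
  >⇒H⁻ {q} lt = mk< (eval t q ℚ.- θ) (0<q-p lt) 0 λ k _ → ℚₚ.≤-reflexive
    (trans (cong (ℚ._+ (eval t q ℚ.- θ)) (seq-normal (fromℚ ∘ q) k)) (gap-≡ (t ^ m) (eval t q) θ))

-- The entry for the constant coefficient is -(t ^ 0) = -1 at every node, t = 0 included.
normal≢0 : ∀ {m} t θ → 1 ℕ.≤ m → NonZeroVec (Hyperplane.normal {m} t θ)
normal≢0 t θ (ℕ.s≤s _) = Fin.zero , inj₁ (mk< 1ℚ (ℚₚ.positive⁻¹ 1ℚ) 0 λ _ _ → ℚₚ.≤-refl)

-- Supports and the VC-dimension

lookup-bounded : ∀ {n} (x : Vec ℕ n) → ∃[ M ] ∀ i → lookup x i ℕ.≤ M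
lookup-bounded [] = 0 , λ ()
lookup-bounded (a ∷ x) with lookup-bounded x
... | M , x≤M = a ℕ.⊔ M , λ
  { Fin.zero    → ℕₚ.m≤m⊔n a M
  ; (Fin.suc i) → ℕₚ.≤-trans (x≤M i) (ℕₚ.m≤n⊔m a M) }

module _ {n : ℕ} where

  support : Vec ℕ n → List (Fin n)
  support x = filter (λ i → 1 ℕₚ.≤? lookup x i) (allFin n)

  support-unique : ∀ x → Unique (support x)
  support-unique x = Uniqueₚ.filter⁺ (λ i → 1 ℕₚ.≤? lookup x i) (Uniqueₚ.allFin⁺ n)

  ∈-support⁺ : ∀ x {i} → 1 ℕ.≤ lookup x i → i ∈ˡ support x
  ∈-support⁺ x {i} = ∈-filter⁺ (λ i → 1 ℕₚ.≤? lookup x i) (∈-allFin i)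

  ∈-support⁻ : ∀ x {i} → i ∈ˡ support x → 1 ℕ.≤ lookup x i
  ∈-support⁻ x i∈ = proj₂ (∈-filter⁻ (λ i → 1 ℕₚ.≤? lookup x i) {xs = allFin n} i∈)

  entries-bounded : (xs : List (Vec ℕ n)) → ∃[ M ] ∀ {x} → x ∈ˡ xs → ∀ i → lookup x i ℕ.≤ M
  entries-bounded [] = 0 , λ ()
  entries-bounded (x ∷ xs) with lookup-bounded x | entries-bounded xs
  ... | A , x≤A | M , xs≤M = A ℕ.⊔ M , λ
    { (here refl) i → ℕₚ.≤-trans (x≤A i) (ℕₚ.m≤m⊔n A M)
    ; (there x∈) i → ℕₚ.≤-trans (xs≤M x∈ i) (ℕₚ.m≤n⊔m A M) }

≤⇒Pointwise : ∀ {n} {x y : Vec ℕ n} → (∀ i → lookup x i ℕ.≤ lookup y i) → Pointwise ℕ._≤_ x y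
≤⇒Pointwise = Extensional.extensional⇒inductive ∘ Extensional.ext

-- The default 0 stands for the absence of a witness between 1 and M, whence the guard before `P v`.
greatest : ∀ {P : ℕ → Set} → Decidable P → ∀ M →
  ∃[ v ] v ℕ.≤ M × (1 ℕ.≤ v → P v) × (∀ {j} → 1 ℕ.≤ j → j ℕ.≤ M → P j → j ℕ.≤ v)
greatest P? zero = 0 , ℕ.z≤n , (λ ()) , λ _ j≤0 _ → j≤0
greatest P? (suc M) with P? (suc M) | greatest P? M
... | yes p | _ = suc M , ℕₚ.≤-refl , (λ _ → p) , λ _ j≤ _ → j≤
... | no ¬p | v , v≤M , Pv , max = v , ℕₚ.m≤n⇒m≤1+n v≤M , Pv ,
  λ {j} 1≤j j≤1+M Pj → case-≤ (ℕₚ.m≤n⇒m<n∨m≡n j≤1+M) 1≤j Pj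
  where
  case-≤ : ∀ {j} → j ℕ.< suc M ⊎ j ≡ suc M → 1 ℕ.≤ j → _ → j ℕ.≤ v
  case-≤ (inj₁ (ℕ.s≤s j≤M)) 1≤j Pj = max 1≤j j≤M Pj
  case-≤ (inj₂ refl)        1≤j Pj = contradiction Pj ¬p

module _ {n : ℕ} {L : Pred (Vec ℕ n) 0ℓ} (ideal : IsIdeal L) where

  -- Take the level-one elements over the support of x. Each subset of them is cut out by a 0-1
  -- vector below x, which the ideal contains.
  support-shattered : ∀ {x} → x ∈ L → ∃[ X ] Subset (idealGround L) X ×
    Shattered (idealFamily L) X × HasSize X (length (support x))
  support-shattered {x} x∈L = X , X⊆U , shattered ,
    List.map (_, 1) (support x) , Uniqueₚ.map⁺ ,-injectiveˡ (support-unique x) ,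
    (λ { (i , j) → mk⇔ (λ { (1≤xᵢ , refl) → ∈-map⁺ (_, 1) (∈-support⁺ x 1≤xᵢ) })
                       (λ e∈ → from-map (∈-map⁻ (_, 1) e∈)) }) ,
    Listₚ.length-map (_, 1) (support x)
    where
    X : Pred (Fin n × ℕ) 0ℓ
    X (i , j) = 1 ℕ.≤ lookup x i × j ≡ 1

    from-map : ∀ {e} → ∃[ i ] i ∈ˡ support x × e ≡ (i , 1) → X e
    from-map (i , i∈ , refl) = ∈-support⁻ x i∈ , refl

    X⊆U : Subset (idealGround L) X
    X⊆U = record
      { decidable = λ { (i , j) → (1 ℕₚ.≤? lookup x i) ×-dec (j ℕₚ.≟ 1) }
      ; included  = λ { (1≤xᵢ , refl) → ℕ.s≤s ℕ.z≤n , x , x∈L , 1≤xᵢ }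
      }

    shattered : Shattered (idealFamily L) X
    shattered Y Y⊆X = idealSet L y , (y , ideal (≤⇒Pointwise y≤x) x∈L , id , id) ,
      (λ { ((_ , 1≤yᵢ) , (_ , refl)) → 1≤y⇒Y _ (subst (1 ℕ.≤_) (Vecₚ.lookup∘tabulate trace _) 1≤yᵢ) }) ,
      (λ { Ye → in-both Ye (Subset.included Y⊆X Ye) })
      where
      open Subset Y⊆X using (decidable)
      trace : Fin n → ℕ
      trace i = if does (decidable (i , 1)) then 1 else 0
      y : Vec ℕ n
      y = tabulate trace
      trace≤x : ∀ i → trace i ℕ.≤ lookup x i
      trace≤x i with decidable (i , 1)
      ... | yes Yi = proj₁ (Subset.included Y⊆X Yi)
      ... | no  _  = ℕ.z≤n
      y≤x : ∀ i → lookup y i ℕ.≤ lookup x i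
      y≤x i = subst (ℕ._≤ lookup x i) (sym (Vecₚ.lookup∘tabulate trace i)) (trace≤x i)
      1≤y⇒Y : ∀ i → 1 ℕ.≤ trace i → Y (i , 1)
      1≤y⇒Y i 1≤ with decidable (i , 1)
      1≤y⇒Y i 1≤ | yes Yi = Yi
      1≤y⇒Y i () | no _
      Y⇒1≤y : ∀ i → Y (i , 1) → 1 ℕ.≤ trace i
      Y⇒1≤y i Yi with decidable (i , 1)
      ... | yes _  = ℕₚ.≤-refl
      ... | no ¬Yi = contradiction Yi ¬Yi
      in-both : ∀ {e} → Y e → X e → e ∈ idealSet L y × X e
      in-both {i , _} Ye (1≤xᵢ , refl) =
        (Subset.included X⊆U (1≤xᵢ , refl) ,
          subst (1 ℕ.≤_) (sym (Vecₚ.lookup∘tabulate trace i)) (Y⇒1≤y i Ye)) , (1≤xᵢ , refl)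

  support-size : ∀ {d} → IsVCDim (idealFamily L) d → ∀ {x} → x ∈ L → length (support x) ℕ.≤ d
  support-size (_ , maximal) x∈L =
    let X , X⊆U , shattered , size = support-shattered x∈L in maximal X _ X⊆U shattered size

-- If x is in L and y is not, then xᵢ < yᵢ for some i, and weight B yᵢ = ε ^ (1 - yᵢ)
-- brings the value of the vertex of x at node i, at least ε ^ xᵢ, up to 1.
weight : ℚ → ℕ → ℚ
weight B zero    = 0ℚ
weight B (suc j) = B ^ j

0≤weight : ∀ {B} → 0ℚ ℚ.≤ B → ∀ j → 0ℚ ℚ.≤ weight B j
0≤weight 0≤B zero    = ℚₚ.≤-refl
0≤weight 0≤B (suc j) = ^-nonneg 0≤B j

weight≤ : ∀ {B} → 1ℚ ℚ.≤ B → ∀ {j M} → j ℕ.≤ M → weight B j ℚ.≤ B ^ M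
weight≤ {B} 1≤B {zero}  {M} _   = ^-nonneg (ℚₚ.≤-trans 0≤1 1≤B) M
weight≤ {B} 1≤B {suc j} {M} j<M = ^-monoʳ-≤ 1≤B (ℕₚ.<⇒≤ j<M)

-- Vertices and cells for given constants

module Construction {n : ℕ} {L : Pred (Vec ℕ n) 0ℓ} (xs : List (Vec ℕ n))
  (L⇔xs : ∀ x → x ∈ L ⇔ x ∈ˡ xs) (ideal : IsIdeal L)
  (d : ℕ) (size : ∀ {x} → x ∈ L → length (support x) ℕ.≤ d)
  {M : ℕ} (L≤M : ∀ {x} → x ∈ L → ∀ i → lookup x i ℕ.≤ M)
  {τ ε B : ℚ} (0<τ : 0ℚ ℚ.< τ) (τ<1 : τ ℚ.< 1ℚ) (τ-sum : node n ℚ.* τ ℚ.+ (τ ℚ.+ τ) ≡ 1ℚ)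
  (0<ε : 0ℚ ℚ.< ε) (ε≤1 : ε ℚ.≤ 1ℚ) (ε<τ : factorBound n ^ d ℚ.* ε ℚ.< τ)
  (0<B : 0ℚ ℚ.< B) (1≤B : 1ℚ ℚ.≤ B) (Bε≡1 : B ℚ.* ε ≡ 1ℚ)
  where

  m : ℕ
  m = d * 2

  0≤B : 0ℚ ℚ.≤ B
  0≤B = ℚₚ.<⇒≤ 0<B

  0≤ε : 0ℚ ℚ.≤ ε
  0≤ε = ℚₚ.<⇒≤ 0<ε

  L? : Decidable L
  L? x with DecMembership._∈?_ (Vecₚ.≡-dec ℕₚ._≟_) x xs
  ... | yes x∈xs = yes (Equivalence.from (L⇔xs x) x∈xs)
  ... | no  x∉xs = no (x∉xs ∘ Equivalence.to (L⇔xs x))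

  -- The bound M on the entries bounds the weights, which gives all `ℓ y` a common Lipschitz
  -- constant.
  NonMember : Set
  NonMember = Σ (Vec ℕ n) λ y → (∀ i → lookup y i ℕ.≤ M) × ¬ y ∈ L

  ℓ : NonMember → Vector ℚ m → ℚ
  ℓ (y , _) q = ∑ λ i → weight B (lookup y i) ℚ.* eval (point i) q

  -- Lipschitz constant of the `ℓ y`: n terms of weight at most B ^ M, each with the constant from
  -- `eval-mono`. Below, 1 is added to keep it positive even when this product is 0.
  stretch : ℚ
  stretch = node n ℚ.* (B ^ M ℚ.* (node m ℚ.* coefficientBound n m))

  0≤stretch : 0ℚ ℚ.≤ stretch
  0≤stretch = *-nonneg (0≤node n) (*-nonneg (^-nonneg 0≤B M)
    (*-nonneg (0≤node m) (0≤coefficientBound n m)))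

  ℓ-mono : ∀ y {u v η} → 0ℚ ℚ.≤ η → (∀ k → u k ℚ.≤ v k ℚ.+ η) →
    ℓ y u ℚ.≤ ℓ y v ℚ.+ (1ℚ ℚ.+ stretch) ℚ.* η
  ℓ-mono (y , y≤M , _) {u} {v} {η} 0≤η u≤v = begin
    ∑ (λ i → w i ℚ.* eval (point i) u)
      ≤⟨ ∑-mono-≤ {g = λ i → w i ℚ.* eval (point i) v} {c = B ^ M ℚ.* δ} term ⟩
    ∑ (λ i → w i ℚ.* eval (point i) v) ℚ.+ node n ℚ.* (B ^ M ℚ.* δ)
      ≤⟨ ≤-offset (solve 6 (λ s n b m a η →
           s :+ (con 1ℚ :+ n :* (b :* (m :* a))) :* η := s :+ n :* (b :* (m :* (a :* η))) :+ η)
         refl (∑ (λ i → w i ℚ.* eval (point i) v)) (node n) (B ^ M) (node m) (coefficientBound n m) η) 0≤η ⟩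
    ∑ (λ i → w i ℚ.* eval (point i) v) ℚ.+ (1ℚ ℚ.+ stretch) ℚ.* η ∎
    where
    open ℚₚ.≤-Reasoning
    w : Fin n → ℚ
    w i = weight B (lookup y i)
    δ : ℚ
    δ = node m ℚ.* (coefficientBound n m ℚ.* η)
    term : ∀ i → w i ℚ.* eval (point i) u ℚ.≤ w i ℚ.* eval (point i) v ℚ.+ B ^ M ℚ.* δ
    term i = begin
      w i ℚ.* eval (point i) u           ≤⟨ *-monoʳ-≤ (0≤weight 0≤B (lookup y i)) (eval-mono i 0≤η u≤v) ⟩
      w i ℚ.* (eval (point i) v ℚ.+ δ)   ≡⟨ ℚₚ.*-distribˡ-+ (w i) (eval (point i) v) δ ⟩
      w i ℚ.* eval (point i) v ℚ.+ w i ℚ.* δ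
        ≤⟨ ℚₚ.+-monoʳ-≤ (w i ℚ.* eval (point i) v) (ℚₚ.*-monoʳ-≤-nonNeg δ
             {{ℚ.nonNegative (*-nonneg (0≤node m) (*-nonneg (0≤coefficientBound n m) 0≤η))}}
             (weight≤ 1≤B (y≤M i))) ⟩
      w i ℚ.* eval (point i) v ℚ.+ B ^ M ℚ.* δ ∎

  ℓ-affine : ∀ y t u v → ℓ y (mix t u v) ≡ (1ℚ ℚ.- t) ℚ.* ℓ y u ℚ.+ t ℚ.* ℓ y v
  ℓ-affine (y , _) t u v = trans
    (∑-cong (λ i → trans (cong (w i ℚ.*_) (eval-affine (point i) t u v))
      (solve 4 (λ w t a b → w :* ((con 1ℚ :- t) :* a :+ t :* b) := (con 1ℚ :- t) :* (w :* a) :+ t :* (w :* b))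
        refl (w i) t (eval (point i) u) (eval (point i) v))))
    (∑-combine (1ℚ ℚ.- t) t (λ i → w i ℚ.* eval (point i) u) (λ i → w i ℚ.* eval (point i) v))
    where
    w : Fin n → ℚ
    w i = weight B (lookup y i)

  open Polyhedron ℓ (node n ℚ.* τ) (1ℚ ℚ.+ stretch)
    (ℚₚ.<-≤-trans (ℚₚ.positive⁻¹ 1ℚ) (≤-offset refl 0≤stretch)) ℓ-mono ℓ-affine

  threshold : ℕ → ℚ
  threshold j = τ ℚ.* ε ^ ℕ.pred j

  threshold-antimono : ∀ {i j} → i ℕ.≤ j → threshold j ℚ.≤ threshold i
  threshold-antimono i≤j = *-monoʳ-≤ (ℚₚ.<⇒≤ 0<τ) (^-antimonoʳ-≤ 0≤ε ε≤1 (ℕₚ.pred-mono-≤ i≤j))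

  module H (e : Fin n × ℕ) = Hyperplane {m} (point (proj₁ e)) (threshold (proj₂ e))

  module Vertex {x : Vec ℕ n} (x∈L : x ∈ L) where

    open Product (λ i → ε ^ lookup x i) (λ i → ^-nonneg 0≤ε (lookup x i))
      (λ i → ^-antimonoʳ-≤ 0≤ε ε≤1 {k = lookup x i} ℕ.z≤n)

    vertex : Vector ℚ m
    vertex = lookup (product d (support x))

    eval-vertex : ∀ i → eval (point i) vertex ∈[ ε ^ lookup x i , factorBound n ^ d ℚ.* ε ^ lookup x i ]
    eval-vertex i = subst (_∈[ ε ^ lookup x i , factorBound n ^ d ℚ.* ε ^ lookup x i ])
      (sym (eval≡monic (point i) (product d (support x)))) (cases (1 ℕₚ.≤? lookup x i))
      where
      cases : Dec (1 ℕ.≤ lookup x i) → monic (product d (support x)) (point i)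
        ∈[ ε ^ lookup x i , factorBound n ^ d ℚ.* ε ^ lookup x i ]
      cases (yes 1≤xᵢ) = product-on d (support-unique x) (∈-support⁺ x 1≤xᵢ) (size x∈L)
      -- Here x_i = 0, so ε ^ x_i is 1, the lower bound off the support.
      cases (no  1≰xᵢ) = subst
        (λ k → monic (product d (support x)) (point i) ∈[ ε ^ k , factorBound n ^ d ℚ.* ε ^ k ])
        (sym (ℕₚ.n<1⇒n≡0 (ℕₚ.≰⇒> 1≰xᵢ)))
        (interval-≡ refl refl (sym (ℚₚ.*-identityʳ _))
          (product-off d (support x) i (All.tabulate λ { s∈ refl → 1≰xᵢ (∈-support⁻ x s∈) })))

    ε^≤eval : ∀ {i k} → lookup x i ℕ.≤ k → ε ^ k ℚ.≤ eval (point i) vertex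
    ε^≤eval {i} xᵢ≤k = ℚₚ.≤-trans (^-antimonoʳ-≤ 0≤ε ε≤1 xᵢ≤k) (proj₁ (eval-vertex i))

    0≤eval : ∀ i → 0ℚ ℚ.≤ eval (point i) vertex
    0≤eval i = ℚₚ.≤-trans (^-nonneg 0≤ε (lookup x i)) (proj₁ (eval-vertex i))

    -- As L is an ideal, y is not below x. A node with x_i < y_i alone contributes at least 1, which
    -- `τ-sum` splits into the level n τ and a gap of 2 τ.
    vertex-inside : Inside (τ ℚ.+ τ) vertex
    vertex-inside (y , _ , y∉L) with Finₚ.¬∀⟶∃¬ n (λ i → lookup y i ℕ.≤ lookup x i)
      (λ i → lookup y i ℕₚ.≤? lookup x i) (λ y≤x → y∉L (ideal (≤⇒Pointwise y≤x) x∈L))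
    ... | i , yᵢ≰xᵢ = begin
      node n ℚ.* τ ℚ.+ (τ ℚ.+ τ)  ≡⟨ τ-sum ⟩
      1ℚ                          ≤⟨ 1≤term (ℕₚ.≰⇒> yᵢ≰xᵢ) ⟩
      weight B (lookup y i) ℚ.* eval (point i) vertex
        ≤⟨ term≤∑ {f = λ i → weight B (lookup y i) ℚ.* eval (point i) vertex}
             (λ i → *-nonneg (0≤weight 0≤B (lookup y i)) (0≤eval i)) i ⟩
      ∑ (λ i → weight B (lookup y i) ℚ.* eval (point i) vertex) ∎
      where
      open ℚₚ.≤-Reasoning
      1≤term : ∀ {k} → lookup x i ℕ.< k → 1ℚ ℚ.≤ weight B k ℚ.* eval (point i) vertex
      1≤term {suc k} (ℕ.s≤s xᵢ≤k) = ℚₚ.≤-trans (ℚₚ.≤-reflexive (sym (^-inverse Bε≡1 k)))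
        (*-monoʳ-≤ (^-nonneg 0≤B k) (ε^≤eval xᵢ≤k))

    -- The bound on the vertex value has a spare factor ε over ε ^ (j - 1), which absorbs the
    -- constant by `ε<τ`.
    below : ∀ {i j} → 1 ℕ.≤ j → j ℕ.≤ lookup x i → eval (point i) vertex ℚ.< threshold j
    below {i} {suc j} _ j<xᵢ = ℚₚ.≤-<-trans (proj₂ (eval-vertex i)) (begin-strict
      factorBound n ^ d ℚ.* ε ^ lookup x i
        ≤⟨ *-monoʳ-≤ (^-nonneg (ℚₚ.≤-trans 0≤1 (1≤factorBound n)) d) (^-antimonoʳ-≤ 0≤ε ε≤1 j<xᵢ) ⟩
      factorBound n ^ d ℚ.* (ε ℚ.* ε ^ j)  ≡⟨ ℚₚ.*-assoc (factorBound n ^ d) ε (ε ^ j) ⟨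
      factorBound n ^ d ℚ.* ε ℚ.* ε ^ j    <⟨ ℚₚ.*-monoˡ-<-pos (ε ^ j) {{ℚ.positive (^-positive 0<ε j)}} ε<τ ⟩
      τ ℚ.* ε ^ j ∎)
      where open ℚₚ.≤-Reasoning

    -- The vertex value is already at least ε ^ (j - 1), so τ < 1 suffices.
    above : ∀ {i j} → 1 ℕ.≤ j → lookup x i ℕ.< j → threshold j ℚ.< eval (point i) vertex
    above {i} {suc j} _ (ℕ.s≤s xᵢ≤j) = ℚₚ.<-≤-trans
      (subst (τ ℚ.* ε ^ j ℚ.<_) (ℚₚ.*-identityˡ (ε ^ j))
        (ℚₚ.*-monoˡ-<-pos (ε ^ j) {{ℚ.positive (^-positive 0<ε j)}} τ<1))
      (ε^≤eval xᵢ≤j)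

    vertex-cell : ∀ {X} → X ≐ idealSet L x → Cell (idealGround L) H.normal H.offset X (fromℚ ∘ vertex)
    vertex-cell (X⊆S , S⊆X) =
      (λ e e∈X → let ((1≤j , _) , j≤xᵢ) = X⊆S e∈X in H.<⇒H⁺ e (below 1≤j j≤xᵢ)) ,
      (λ e e∈U e∉X → H.>⇒H⁻ e (above (proj₁ e∈U) (ℕₚ.≰⇒> λ j≤xᵢ → e∉X (S⊆X (e∈U , j≤xᵢ)))))

  -- Reads off a vector x whose entry at i is the highest level of X over i. The cell makes X the
  -- set of x, and `K` forces x into L.
  module Decode {X : Pred (Fin n × ℕ) 0ℓ} (X⊆U : Subset (idealGround L) X)
    {p : Vector ℝ m} (p∈K : p ∈ K) (p∈cell : Cell (idealGround L) H.normal H.offset X p) where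

    open Subset X⊆U

    top : (i : Fin n) → _
    top i = greatest (λ j → decidable (i , j)) M

    x : Vec ℕ n
    x = tabulate (proj₁ ∘ top)

    lookup-x : ∀ i → lookup x i ≡ proj₁ (top i)
    lookup-x = Vecₚ.lookup∘tabulate (proj₁ ∘ top)

    x≤M : ∀ i → lookup x i ℕ.≤ M
    x≤M i = subst (ℕ._≤ M) (sym (lookup-x i)) (proj₁ (proj₂ (top i)))

    top∈X : ∀ i → 1 ℕ.≤ lookup x i → X (i , lookup x i)
    top∈X i = subst (λ v → 1 ℕ.≤ v → X (i , v)) (sym (lookup-x i)) (proj₁ (proj₂ (proj₂ (top i))))

    X⇒≤x : ∀ {i j} → X (i , j) → j ℕ.≤ lookup x i
    X⇒≤x {i} {j} e∈X with included e∈X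
    ... | 1≤j , y , y∈L , j≤yᵢ = subst (j ℕ.≤_) (sym (lookup-x i))
      (proj₂ (proj₂ (proj₂ (top i))) 1≤j (ℕₚ.≤-trans j≤yᵢ (L≤M y∈L i)) e∈X)

    -- Thresholds do not increase with the level, so p(i) cannot lie below the one for x_i and above
    -- the one for j ≤ x_i.
    ≤x⇒X : ∀ {i j} → (i , j) ∈ idealGround L → j ℕ.≤ lookup x i → X (i , j)
    ≤x⇒X {i} {j} e∈U j≤xᵢ with decidable (i , j)
    ... | yes e∈X = e∈X
    ... | no  e∉X = ⊥-elim (eventually-⊥ (eventually-map
      (λ { (lo , hi) → ℚₚ.<-irrefl refl
        (ℚₚ.<-trans lo (ℚₚ.≤-<-trans (threshold-antimono j≤xᵢ) hi)) })
      (eventually-×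
        (H.H⁺⇒< (i , lookup x i) (proj₁ p∈cell _ (top∈X i (ℕₚ.≤-trans (proj₁ e∈U) j≤xᵢ))))
        (H.H⁻⇒> (i , j) (proj₂ p∈cell (i , j) e∈U e∉X)))))

    -- For k ≥ 1 the weight B ^ (k - 1) is inverse to the power of ε in `threshold k`; for k = 0 the
    -- weight vanishes.
    weighted≤τ : ∀ {v k} → (1 ℕ.≤ k → v ℚ.< threshold k) → weight B k ℚ.* v ℚ.≤ τ
    weighted≤τ {v} {zero}  _  = subst (ℚ._≤ τ) (sym (ℚₚ.*-zeroˡ v)) (ℚₚ.<⇒≤ 0<τ)
    weighted≤τ {v} {suc k} v< = begin
      B ^ k ℚ.* v               ≤⟨ *-monoʳ-≤ (^-nonneg 0≤B k) (ℚₚ.<⇒≤ (v< (ℕ.s≤s ℕ.z≤n))) ⟩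
      B ^ k ℚ.* (τ ℚ.* ε ^ k)   ≡⟨ solve 3 (λ b t e → b :* (t :* e) := t :* (b :* e)) refl (B ^ k) τ (ε ^ k) ⟩
      τ ℚ.* (B ^ k ℚ.* ε ^ k)   ≡⟨ cong (τ ℚ.*_) (^-inverse Bε≡1 k) ⟩
      τ ℚ.* 1ℚ                  ≡⟨ ℚₚ.*-identityʳ τ ⟩
      τ ∎
      where open ℚₚ.≤-Reasoning

    eval<threshold : ∀ i → Eventually (λ k → 1 ℕ.≤ lookup x i → eval (point i) (at p k) ℚ.< threshold (lookup x i))
    eval<threshold i with 1 ℕₚ.≤? lookup x i
    ... | yes 1≤xᵢ = eventually-map (λ lt _ → lt) (H.H⁺⇒< (i , lookup x i) (proj₁ p∈cell _ (top∈X i 1≤xᵢ)))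
    ... | no  1≰xᵢ = 0 , λ _ _ 1≤xᵢ → contradiction 1≤xᵢ 1≰xᵢ

    -- Outside L, x would index one of the inequalities of `K`, but its n terms are at most τ each
    -- and cannot sum to more than n τ.
    x∈L : x ∈ L
    x∈L with L? x
    ... | yes x∈L = x∈L
    ... | no  x∉L = let g , 0<g , inside = p∈K in ⊥-elim (eventually-⊥ (eventually-map
      (λ { {k} (inₚ , small) → ℚₚ.<-irrefl refl (begin-strict
        node n ℚ.* τ                ≡⟨ ℚₚ.+-identityʳ (node n ℚ.* τ) ⟨
        node n ℚ.* τ ℚ.+ 0ℚ         <⟨ ℚₚ.+-monoʳ-< (node n ℚ.* τ) 0<g ⟩
        node n ℚ.* τ ℚ.+ g          ≤⟨ inₚ (x , x≤M , x∉L) ⟩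
        ∑ (λ i → weight B (lookup x i) ℚ.* eval (point i) (at p k))
          ≤⟨ ∑≤ (λ i → weighted≤τ {k = lookup x i} (small i)) ⟩
        node n ℚ.* τ ∎) })
      (eventually-× inside (eventually-∀ eval<threshold))))
      where open ℚₚ.≤-Reasoning

    member : X ∈ members (idealFamily L)
    member = x , x∈L , (λ e∈X → included e∈X , X⇒≤x e∈X) , (λ { (e∈U , j≤xᵢ) → ≤x⇒X e∈U j≤xᵢ })

  -- A ground element comes from a member of L with nonempty support, so d ≥ 1.
  1≤m : ∀ {e} → e ∈ idealGround L → 1 ℕ.≤ m
  1≤m {i , j} (1≤j , x , x∈L , j≤xᵢ) = ℕₚ.*-mono-≤ {1} {d} {1} {2} 1≤d (ℕ.s≤s ℕ.z≤n)
    where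
    1≤length : ∀ {ys} → i ∈ˡ ys → 1 ℕ.≤ length ys
    1≤length (here _)  = ℕ.s≤s ℕ.z≤n
    1≤length (there _) = ℕ.s≤s ℕ.z≤n
    1≤d : 1 ℕ.≤ d
    1≤d = ℕₚ.≤-trans (1≤length (∈-support⁺ x (ℕₚ.≤-trans 1≤j j≤xᵢ))) (size x∈L)

  realization : Realization (idealFamily L) m
  realization = record
    { normal         = H.normal
    ; offset         = H.offset
    ; normal≠0       = λ {e} e∈U → normal≢0 (point (proj₁ e)) (threshold (proj₂ e)) (1≤m e∈U)
    ; K              = K
    ; respectsEq     = K-respectsEq
    ; convex         = λ {x} {y} → K-convex {x} {y}
    ; relativelyOpen = K-relativelyOpen
    ; realizes       = λ X X⊆U → mk⇔
        (λ { (x , x∈L , X≐S) → let open Vertex x∈L in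
          fromℚ ∘ vertex , (τ ℚ.+ τ , ℚₚ.+-mono-< 0<τ 0<τ , 0 , λ _ _ → vertex-inside) , vertex-cell X≐S })
        (λ { (p , p∈K , p∈cell) → Decode.member X⊆U p∈K p∈cell })
    }

-- Choice of the constants

realize : ∀ {n} {L : Pred (Vec ℕ n) 0ℓ} → Finite L → IsIdeal L →
  ∀ {d} → IsVCDim (idealFamily L) d → Realization (idealFamily L) (d * 2)
realize {n} (xs , L⇔xs) ideal {d} vc
  with entries-bounded xs
     -- This gives τ = 1 / (n + 2), so that n τ stays 2 τ below 1.
     | scale (1ℚ ℚ.+ (1ℚ ℚ.+ node n))
         (ℚₚ.+-mono-<-≤ (ℚₚ.positive⁻¹ 1ℚ) (+-nonneg 0≤1 (0≤node n)))
         1ℚ (ℚₚ.positive⁻¹ 1ℚ)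
... | M , xs≤M | τ , 0<τ , Tτ≡1 with half τ 0<τ
-- With h = τ / 2 and ε = h / D ^ d, where D is `factorBound n`, the product D ^ d ε equals h and is
-- strictly below τ.
... | h , 0<h , h+h≡τ with scale (factorBound n ^ d) 0<C h 0<h
  where
  0<C : 0ℚ ℚ.< factorBound n ^ d
  0<C = ^-positive (ℚₚ.<-≤-trans (ℚₚ.positive⁻¹ 1ℚ) (1≤factorBound n)) d
... | ε , 0<ε , Cε≡h with scale ε 0<ε 1ℚ (ℚₚ.positive⁻¹ 1ℚ)
... | B , 0<B , εB≡1 = Construction.realization xs L⇔xs ideal d (support-size ideal vc)
  (λ {x} x∈L → xs≤M (Equivalence.to (L⇔xs x) x∈L))
  0<τ τ<1 τ-sum 0<ε ε≤1 (subst (ℚ._< τ) (sym Cε≡h) h<τ) 0<B 1≤B (trans (ℚₚ.*-comm B ε) εB≡1)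
  where
  open ℚₚ.≤-Reasoning
  τ-sum : node n ℚ.* τ ℚ.+ (τ ℚ.+ τ) ≡ 1ℚ
  τ-sum = trans (solve 2 (λ n t → n :* t :+ (t :+ t) := (con 1ℚ :+ (con 1ℚ :+ n)) :* t) refl (node n) τ) Tτ≡1
  τ<1 : τ ℚ.< 1ℚ
  τ<1 = begin-strict
    τ                           ≡⟨ ℚₚ.+-identityˡ τ ⟨
    0ℚ ℚ.+ τ                    <⟨ ℚₚ.+-monoˡ-< τ 0<τ ⟩
    τ ℚ.+ τ                     ≤⟨ ≤-offset (ℚₚ.+-comm (node n ℚ.* τ) (τ ℚ.+ τ)) (*-nonneg (0≤node n) (ℚₚ.<⇒≤ 0<τ)) ⟩
    node n ℚ.* τ ℚ.+ (τ ℚ.+ τ)  ≡⟨ τ-sum ⟩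
    1ℚ ∎
  h<τ : h ℚ.< τ
  h<τ = begin-strict
    h          ≡⟨ ℚₚ.+-identityˡ h ⟨
    0ℚ ℚ.+ h   <⟨ ℚₚ.+-monoˡ-< h 0<h ⟩
    h ℚ.+ h    ≡⟨ h+h≡τ ⟩
    τ ∎
  ε≤1 : ε ℚ.≤ 1ℚ
  ε≤1 = begin
    ε                            ≡⟨ ℚₚ.*-identityˡ ε ⟨
    1ℚ ℚ.* ε                     ≤⟨ ℚₚ.*-monoʳ-≤-nonNeg ε {{ℚ.nonNegative (ℚₚ.<⇒≤ 0<ε)}} (1≤^ (1≤factorBound n) d) ⟩
    factorBound n ^ d ℚ.* ε      ≡⟨ Cε≡h ⟩
    h                            <⟨ ℚₚ.<-trans h<τ τ<1 ⟩
    1ℚ ∎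
  1≤B : 1ℚ ℚ.≤ B
  1≤B = begin
    1ℚ        ≡⟨ εB≡1 ⟨
    ε ℚ.* B   ≤⟨ ℚₚ.*-monoʳ-≤-nonNeg B {{ℚ.nonNegative (ℚₚ.<⇒≤ 0<B)}} ε≤1 ⟩
    1ℚ ℚ.* B  ≡⟨ ℚₚ.*-identityˡ B ⟩
    B ∎

theorem43 : (n : ℕ) (L : Pred (Vec ℕ n) 0ℓ) →
    Finite L → Satisfiable L → IsIdeal L →
    (d : ℕ) → IsVCDim (idealFamily L) d →
    Realization (idealFamily L) (2 * d) ×
    ((m : ℕ) → IsEuclideanDim (idealFamily L) m → m ≤ 2 * d)
theorem43 n L finite _ ideal d vc = R , λ { m (_ , minimal) → minimal (2 * d) R }
  where
  R : Realization (idealFamily L) (2 * d)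
  R = subst (Realization (idealFamily L)) (ℕₚ.*-comm d 2) (realize finite ideal vc)
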